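{- For every $n \geq 0$, there is a bijection $\rho$ between the set $\mathcal{M}_n$ of rooted planar maps with $n$ edges and the set $\mathcal{V}_n$ of v-trees with $n$ edges such that, for every $M \in \mathcal{M}_n$, the label of the root of $\rho(M)$ equals $\operatorname{outv}(M)$.
   Context: A rooted planar map is a planar map with a marked corner on the outer face; the empty map (single vertex) is the only map with $0$ edges. $\operatorname{outv}(M)$ is the number of vertices of $M$ incident to the outer face. A v-tree is a plane tree with integer node labels $\ell$ such that: (i) leaves have label $0$ or $1$; (ii) every non-root node $u$ with children $v_1,\ldots,v_k$ satisfies $0 \le \ell(u) \le 1+\sum_{i=1}^k \ell(v_i)$; (iii) the root $r$ with children $v_1,\ldots,v_k$ satisfies $\ell(r) = 1+\sum_{i=1}^k \ell(v_i)$. The size of a v-tree is its number of edges. -}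

module Defs where

open import Data.Fin.Base using (Fin)
open import Data.Fin.Permutation using (Permutation′; _⟨$⟩ʳ_; _⟨$⟩ˡ_; inverseʳ; inverseˡ; id; flip; _∘ₚ_)
open import Data.Fin.Properties using (_≟_; any?)
open import Data.Integer.Base as ℤ using (ℤ; 0ℤ; 1ℤ)
open import Data.List.Base using (List; []; _∷_; map; foldr; length; filter; allFin)
open import Data.List.Relation.Unary.All using (All)
open import Data.Nat.Base using (ℕ; zero; suc; _+_; _*_)
open import Data.Product.Base using (_×_; _,_; ∃)
open import Data.Sum.Base using (_⊎_)
open import Function.Bundles using (_⇔_)
open import Function.Definitions using (Surjective)
open import Level using (0ℓ)
open import Relation.Binary.Bundles using (Setoid)
open import Relation.Binary.Construct.Closure.Equivalence using (EqClosure)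
import Relation.Binary.Construct.On as On
open import Relation.Binary.Construct.Union using (_∪_)
open import Relation.Binary.Core using (Rel)
open import Relation.Binary.PropositionalEquality
  using (_≡_; _≢_; refl; sym; trans; cong; setoid; module ≡-Reasoning)
open import Relation.Nullary.Decidable using (Dec; _×-dec_)

------------------------------------------------------------------------
-- Rooted planar maps

Graph : ∀ {A : Set} → (A → A) → Rel A 0ℓ
Graph f x y = f x ≡ y

-- The classes of the equivalence relation generated by R are numbered
-- 0, …, k - 1.  For R = Graph f with f a permutation, these classes are
-- the orbits of f.

record Classes {A : Set} (R : Rel A 0ℓ) (k : ℕ) : Set where
  field
    class      : A → Fin k
    surjective : Surjective _≡_ _≡_ class
    same-class : ∀ {x y} → class x ≡ class y ⇔ EqClosure R x y

-- A map with n edges has 2n darts (half-edges): σ turns clockwise around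
-- the origin of a dart, and α exchanges the two darts of an edge.  Walking
-- along d with its left face kept on the left, the next dart is σ (α d).
-- So vertices are orbits of σ, faces are orbits of φ = σ ∘ α, and d stands
-- for the corner at its origin in the face on its left.
-- The map is connected, and planarity is Euler's formula V - E + F = 2.
-- The numberings of vertices and faces are determined up to renumbering,
-- and are ignored by isomorphisms.

record CombinatorialMap (n : ℕ) : Set where
  field
    σ            : Permutation′ (2 * n)
    α            : Fin (2 * n) → Fin (2 * n)
    α-involutive : ∀ d → α (α d) ≡ d
    α-fixfree    : ∀ d → α d ≢ d
    connected    : ∀ d e → EqClosure (Graph (σ ⟨$⟩ʳ_) ∪ Graph α) d e
    root         : Fin (2 * n)

  φ : Fin (2 * n) → Fin (2 * n)
  φ d = σ ⟨$⟩ʳ α d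

  field
    #vertices : ℕ
    #faces    : ℕ
    vertices  : Classes (Graph (σ ⟨$⟩ʳ_)) #vertices
    faces     : Classes (Graph φ) #faces
    euler     : #vertices + #faces ≡ n + 2

  vertexOf : Fin (2 * n) → Fin #vertices
  vertexOf = Classes.class vertices

  faceOf : Fin (2 * n) → Fin #faces
  faceOf = Classes.class faces

  OnOuterFace : Fin #vertices → Set
  OnOuterFace v = ∃ λ d → vertexOf d ≡ v × faceOf d ≡ faceOf root

  onOuterFace? : ∀ v → Dec (OnOuterFace v)
  onOuterFace? v = any? λ d → (vertexOf d ≟ v) ×-dec (faceOf d ≟ faceOf root)

-- The map without edges has no darts, and is treated apart:
-- CombinatorialMap 0 is uninhabited, as it requires a root dart.

data RootedPlanarMap : ℕ → Set where
  singleVertex : RootedPlanarMap 0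
  fromDarts    : ∀ {n} → CombinatorialMap n → RootedPlanarMap n

outv : ∀ {n} → RootedPlanarMap n → ℕ
outv singleVertex  = 1
outv (fromDarts M) = length (filter onOuterFace? (allFin #vertices))
  where open CombinatorialMap M

record Isomorphism {n} (M N : CombinatorialMap n) : Set where
  private
    module M = CombinatorialMap M
    module N = CombinatorialMap N
  field
    π      : Permutation′ (2 * n)
    π-σ    : ∀ d → π ⟨$⟩ʳ (M.σ ⟨$⟩ʳ d) ≡ N.σ ⟨$⟩ʳ (π ⟨$⟩ʳ d)
    π-α    : ∀ d → π ⟨$⟩ʳ M.α d ≡ N.α (π ⟨$⟩ʳ d)
    π-root : π ⟨$⟩ʳ M.root ≡ N.root

data _≅_ : ∀ {n} → RootedPlanarMap n → RootedPlanarMap n → Set where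
  singleVertex : singleVertex ≅ singleVertex
  fromDarts    : ∀ {n} {M N : CombinatorialMap n} →
                 Isomorphism M N → fromDarts M ≅ fromDarts N

≅-refl : ∀ {n} {M : RootedPlanarMap n} → M ≅ M
≅-refl {M = singleVertex} = singleVertex
≅-refl {M = fromDarts M}  = fromDarts record
  { π = id ; π-σ = λ _ → refl ; π-α = λ _ → refl ; π-root = refl }

private
  flip-commutes : ∀ {m} (π : Permutation′ m) {f g : Fin m → Fin m} →
                  (∀ d → π ⟨$⟩ʳ f d ≡ g (π ⟨$⟩ʳ d)) →
                  ∀ d → π ⟨$⟩ˡ g d ≡ f (π ⟨$⟩ˡ d)
  flip-commutes π {f} {g} eq d = begin
    π ⟨$⟩ˡ g d                      ≡⟨ cong (λ x → π ⟨$⟩ˡ g x) (inverseʳ π) ⟨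
    π ⟨$⟩ˡ g (π ⟨$⟩ʳ (π ⟨$⟩ˡ d))    ≡⟨ cong (π ⟨$⟩ˡ_) (eq (π ⟨$⟩ˡ d)) ⟨
    π ⟨$⟩ˡ (π ⟨$⟩ʳ f (π ⟨$⟩ˡ d))    ≡⟨ inverseˡ π ⟩
    f (π ⟨$⟩ˡ d)                    ∎
    where open ≡-Reasoning

≅-sym : ∀ {n} {M N : RootedPlanarMap n} → M ≅ N → N ≅ M
≅-sym singleVertex  = singleVertex
≅-sym (fromDarts i) = fromDarts record
  { π      = flip π
  ; π-σ    = flip-commutes π π-σ
  ; π-α    = flip-commutes π π-α
  ; π-root = trans (cong (π ⟨$⟩ˡ_) (sym π-root)) (inverseˡ π)
  }
  where open Isomorphism i

≅-trans : ∀ {n} {M N P : RootedPlanarMap n} → M ≅ N → N ≅ P → M ≅ P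
≅-trans singleVertex  singleVertex  = singleVertex
≅-trans (fromDarts i) (fromDarts j) = fromDarts record
  { π      = I.π ∘ₚ J.π
  ; π-σ    = λ d → trans (cong (J.π ⟨$⟩ʳ_) (I.π-σ d)) (J.π-σ _)
  ; π-α    = λ d → trans (cong (J.π ⟨$⟩ʳ_) (I.π-α d)) (J.π-α _)
  ; π-root = trans (cong (J.π ⟨$⟩ʳ_) I.π-root) J.π-root
  }
  where
    module I = Isomorphism i
    module J = Isomorphism j

𝓜 : ℕ → Setoid 0ℓ 0ℓ
𝓜 n = record
  { Carrier       = RootedPlanarMap n
  ; _≈_           = _≅_
  ; isEquivalence = record { refl = ≅-refl ; sym = ≅-sym ; trans = ≅-trans }
  }

------------------------------------------------------------------------
-- v-trees

-- Data.Tree.Rose relies on sized types, which --safe rejects.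

data LabelledTree : Set where
  node : ℤ → List LabelledTree → LabelledTree

label : LabelledTree → ℤ
label (node ℓ _) = ℓ

children : LabelledTree → List LabelledTree
children (node _ ts) = ts

mutual
  #edges : LabelledTree → ℕ
  #edges (node _ ts) = #edges′ ts

  -- Each tree of the list counts together with the edge to its parent.
  #edges′ : List LabelledTree → ℕ
  #edges′ []       = 0
  #edges′ (t ∷ ts) = suc (#edges t) + #edges′ ts

childSum : LabelledTree → ℤ
childSum t = foldr ℤ._+_ 0ℤ (map label (children t))

-- Every node of a tree satisfies P, where P may look at the whole subtree
-- hanging from that node.

data AllNodes (P : LabelledTree → Set) : LabelledTree → Set where
  node : ∀ {ℓ ts} → P (node ℓ ts) → All (AllNodes P) ts → AllNodes P (node ℓ ts)

LeafCondition : LabelledTree → Set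
LeafCondition u = children u ≡ [] → label u ≡ 0ℤ ⊎ label u ≡ 1ℤ

NonRootCondition : LabelledTree → Set
NonRootCondition u = 0ℤ ℤ.≤ label u × label u ℤ.≤ 1ℤ ℤ.+ childSum u

record IsVTree (t : LabelledTree) : Set where
  field
    leaves  : AllNodes LeafCondition t
    nonRoot : All (AllNodes NonRootCondition) (children t)
    root    : label t ≡ 1ℤ ℤ.+ childSum t

record VTree (n : ℕ) : Set where
  field
    tree    : LabelledTree
    isVTree : IsVTree tree
    size    : #edges tree ≡ n

rootLabel : ∀ {n} → VTree n → ℤ
rootLabel T = label (VTree.tree T)

𝓥 : ℕ → Setoid 0ℓ 0ℓ
𝓥 n = On.setoid {B = VTree n} (setoid LabelledTree) VTree.tree

{-# OPTIONS --safe #-}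
module Submission where

-- The root corner of a map is marked by an extra dart fixed by α, a leg.  Then
-- the empty map is a lone leg, and several rooted maps can coexist as the
-- components of one pair (σ, α) on a fixed set of darts.
--
-- Let p be the leg of a non-empty map, y z with y = σ p its root edge, and q
-- the first dart back at the vertex of p on the outer face after y.  Exchanging
-- σ y and q in σ splits the vertex of p; by Euler's inequality this makes the
-- root edge a bridge, and removing it leaves two planar maps with legs z and y.
-- If ℓ vertices are met before q, then ℓ ≤ outv of the map at z, every such ℓ
-- occurs exactly once (the bound being a root edge that was already a bridge),
-- and outv of the whole is ℓ + outv of the map at y.  So the map at z supplies
-- the children of a node labelled ℓ, and the map at y its right siblings; as
-- outv is 1 for the empty map, 1 + the sum of the labels of the siblings is outv.
--
-- Each step multiplies σ and α by transpositions and can be undone, which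
-- rebuilds the map from the forest on any numbered set of darts.

open import Defs
open import Data.Empty using (⊥; ⊥-elim)
open import Data.Fin.Base
  using (Fin; zero; suc; punchIn; punchOut; toℕ; splitAt; join; _↑ˡ_; _↑ʳ_; cast; combine;
         remQuot)
open import Data.Fin.Permutation
  using (Permutation′; permutation; _⟨$⟩ʳ_; _⟨$⟩ˡ_; inverseˡ; remove; lift₀-remove)
open import Data.Fin.Permutation.Components using (transpose)
open import Data.Fin.Properties
  using (_≟_; any?; pigeonhole; injective⇒≤; punchOut-cong; punchOut-injective;
         punchOut-punchIn; punchInᵢ≢i; splitAt-↑ˡ; splitAt-↑ʳ; join-splitAt; splitAt⁻¹-↑ˡ;
         splitAt⁻¹-↑ʳ; ↑ˡ-injective; ↑ʳ-injective; suc-injective; combine-injective;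
         combine-remQuot; cast-involutive; toℕ-cast; toℕ-injective)
open import Data.Integer.Base as ℤ using (ℤ; +_; 0ℤ; 1ℤ; +≤+)
import Data.Integer.Properties as ℤ
open import Data.List.Base using (List; []; _∷_; allFin; map; foldr; filter; lookup)
open import Data.List.Membership.Propositional using (_∈_)
open import Data.List.Membership.Propositional.Properties
  using (∈-allFin; ∈-filter⁺; ∈-filter⁻; ∈-lookup)
open import Data.List.Relation.Unary.All using (All; []; _∷_)
import Data.List.Relation.Unary.All as All
open import Data.List.Relation.Unary.AllPairs using ([]; _∷_)
open import Data.List.Relation.Unary.Any using (here; there; index)
open import Data.List.Relation.Unary.Any.Properties using (lookup-index)
open import Data.List.Relation.Unary.Unique.Propositional using (Unique)
open import Data.List.Relation.Unary.Unique.Propositional.Properties using (filter⁺; allFin⁺)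
open import Data.Nat.Base using (ℕ; zero; suc; _+_; _*_; _∸_; _≤_; _<_; z≤n; s≤s; s≤s⁻¹)
open import Data.Nat.GeneralisedArithmetic using (fold; fold-+)
import Data.Nat.Properties as ℕ
open import Data.Nat.Tactic.RingSolver using (solve-∀)
open import Data.Product.Base using (Σ-syntax; _×_; _,_; ∃; proj₁; proj₂; uncurry)
open import Data.Sum.Base using (_⊎_; inj₁; inj₂; [_,_]′)
open import Function.Base using (_∘_; id; case_of_)
open import Function.Bundles using (mk⇔; module Equivalence; Bijection)
open import Function.Definitions using (Injective)
open import Level using (0ℓ)
open import Relation.Binary.Construct.Closure.Equivalence as Eq using (EqClosure; _⋆)
open import Relation.Binary.Construct.Closure.ReflexiveTransitive using (ε; _◅_; _◅◅_)
open import Relation.Binary.Construct.Closure.Symmetric using (fwd; bwd)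
import Relation.Binary.Construct.On as On
open import Relation.Binary.Construct.Union using (_∪_)
open import Relation.Binary.Core using (Rel; _⇒_)
open import Relation.Binary.PropositionalEquality
open import Relation.Binary.Structures using (IsEquivalence)
open import Relation.Nullary.Decidable using (Dec; yes; no; map′; ¬?; decidable-stable)
open import Relation.Nullary.Negation using (¬_; contradiction)

private
  variable
    A B : Set
    R S : Rel A 0ℓ
    k l m n : ℕ

~sym : ∀ {x y : A} → EqClosure R x y → EqClosure R y x
~sym = Eq.symmetric _

-- Counting classes

Edge : A → A → Rel A 0ℓ
Edge a b x y = a ≡ x × b ≡ y

edge : ∀ {a b : A} → EqClosure (R ∪ Edge a b) a b
edge = Eq.return (inj₂ (refl , refl))

∪ˡ : EqClosure R ⇒ EqClosure (R ∪ S)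
∪ˡ = Eq.map inj₁

drop-edge : ∀ {a b : A} → EqClosure R a b → EqClosure (R ∪ Edge a b) ⇒ EqClosure R
drop-edge r = (λ { (inj₁ s) → Eq.return s ; (inj₂ (refl , refl)) → r }) ⋆

Classes-resp : R ⇒ EqClosure S → S ⇒ EqClosure R → Classes R k → Classes S k
Classes-resp f g c = record
  { class      = class
  ; surjective = surjective
  ; same-class = mk⇔ (λ eq → (f ⋆) (Equivalence.to same-class eq))
                     (λ r → Equivalence.from same-class ((g ⋆) r))
  }
  where open Classes c

module _ (c : Classes R k) where
  open Classes c

  representative : Fin k → _
  representative i = proj₁ (surjective i)

  class-representative : ∀ i → class (representative i) ≡ i
  class-representative i = proj₂ (surjective i) refl

  ~? : ∀ x y → Dec (EqClosure R x y)
  ~? x y = map′ (Equivalence.to same-class) (Equivalence.from same-class) (class x ≟ class y)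

Classes-≤ : Classes R k → Classes R l → k ≤ l
Classes-≤ c d = injective⇒≤ {f = λ i → D.class (representative c i)} λ {i} {j} eq →
  trans (sym (class-representative c i))
    (trans (Equivalence.from C.same-class (Equivalence.to D.same-class eq))
      (class-representative c j))
  where
  module C = Classes c
  module D = Classes d

Classes-unique : Classes R k → Classes R l → k ≡ l
Classes-unique c d = ℕ.≤-antisym (Classes-≤ c d) (Classes-≤ d c)

module _ {a b : Fin (suc k)} (b≢a : b ≢ a) where
  merge : Fin (suc k) → Fin k
  merge i with b ≟ i
  ... | yes _  = punchOut b≢a
  ... | no b≢i = punchOut b≢i

  merge-≡ : merge a ≡ merge b
  merge-≡ with b ≟ b | b ≟ a
  ... | no b≢b | _       = contradiction refl b≢b
  ... | yes _  | yes b≡a = contradiction b≡a b≢a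
  ... | yes _  | no _    = punchOut-cong b refl

  merge-punchIn : ∀ i → merge (punchIn b i) ≡ i
  merge-punchIn i with b ≟ punchIn b i
  ... | yes eq = contradiction (sym eq) (punchInᵢ≢i b i)
  ... | no b≢  = trans (punchOut-cong b refl) (punchOut-punchIn b {i})

  merge-injective : ∀ i j → merge i ≡ merge j → i ≡ j ⊎ (b ≡ i × a ≡ j) ⊎ (a ≡ i × b ≡ j)
  merge-injective i j eq with b ≟ i | b ≟ j
  ... | yes p | yes q = inj₁ (trans (sym p) q)
  ... | yes p | no q  = inj₂ (inj₁ (p , punchOut-injective b≢a q eq))
  ... | no p  | yes q = inj₂ (inj₂ (sym (punchOut-injective p b≢a eq) , q))
  ... | no p  | no q  = inj₁ (punchOut-injective p q eq)

add-related : ∀ {a b : A} → EqClosure R a b → Classes R k → Classes (R ∪ Edge a b) k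
add-related r = Classes-resp (Eq.return ∘ inj₁) (drop-edge r ∘ Eq.return)

add-unrelated : ∀ {a b : A} → ¬ EqClosure R a b → Classes R (suc k) → Classes (R ∪ Edge a b) k
add-unrelated {R = R} {a = a} {b = b} ¬r c = record
  { class      = merge b≢a ∘ class
  ; surjective = λ i → representative c (punchIn (class b) i) , λ { refl →
      trans (cong (merge b≢a) (class-representative c _)) (merge-punchIn b≢a i) }
  ; same-class = λ {x} {y} → mk⇔ (to x y) from
  }
  where
  open Classes c
  b≢a : class b ≢ class a
  b≢a eq = ¬r (Equivalence.to same-class (sym eq))
  old : ∀ {x y} → class x ≡ class y → EqClosure (R ∪ Edge a b) x y
  old eq = ∪ˡ (Equivalence.to same-class eq)
  to : ∀ x y → merge b≢a (class x) ≡ merge b≢a (class y) → EqClosure (R ∪ Edge a b) x y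
  to x y eq with merge-injective b≢a (class x) (class y) eq
  ... | inj₁ p              = old p
  ... | inj₂ (inj₁ (p , q)) = old (sym p) ◅◅ ~sym edge ◅◅ old q
  ... | inj₂ (inj₂ (p , q)) = old (sym p) ◅◅ edge ◅◅ old q
  from : ∀ {x y} → EqClosure (R ∪ Edge a b) x y → merge b≢a (class x) ≡ merge b≢a (class y)
  from = Eq.fold (On.isEquivalence (merge b≢a ∘ class) isEquivalence) λ
    { (inj₁ r)             → cong (merge b≢a) (Equivalence.from same-class (Eq.return r))
    ; (inj₂ (refl , refl)) → merge-≡ b≢a }

add-edge : Classes R k → ∀ (a b : A) → ∃ (Classes (R ∪ Edge a b))
add-edge {k = zero}  c a b = case Classes.class c a of λ ()
add-edge {k = suc k} c a b with ~? c a b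
... | yes r = suc k , add-related r c
... | no ¬r = k , add-unrelated ¬r c

add-graph : ∀ {R : Rel (Fin m) 0ℓ} → Classes R k → (f : Fin m → Fin m) → ∃ (Classes (R ∪ Graph f))
add-graph {m = m} {R = R} c f = let (k , d) = go (allFin m) in k ,
  Classes-resp (λ { (inj₁ r) → Eq.return (inj₁ r) ; (inj₂ (_ , eq)) → Eq.return (inj₂ eq) })
               (λ { (inj₁ r) → Eq.return (inj₁ r) ; (inj₂ eq) → Eq.return (inj₂ (∈-allFin _ , eq)) }) d
  where
  GraphOn : List (Fin m) → Rel (Fin m) 0ℓ
  GraphOn xs x y = x ∈ xs × f x ≡ y
  go : ∀ xs → ∃ (Classes (R ∪ GraphOn xs))
  go []       = _ , Classes-resp (Eq.return ∘ inj₁) (λ { (inj₁ r) → Eq.return r ; (inj₂ (() , _)) }) c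
  go (x ∷ xs) = let (_ , d) = go xs ; (k , e) = add-edge d x (f x) in k , Classes-resp
    (λ { (inj₁ (inj₁ r)) → Eq.return (inj₁ r)
       ; (inj₁ (inj₂ (i , eq))) → Eq.return (inj₂ (there i , eq))
       ; (inj₂ (refl , eq)) → Eq.return (inj₂ (here refl , eq)) })
    (λ { (inj₁ r) → Eq.return (inj₁ (inj₁ r))
       ; (inj₂ (here refl , eq)) → Eq.return (inj₂ (refl , eq))
       ; (inj₂ (there i , eq)) → Eq.return (inj₁ (inj₂ (i , eq))) }) e

discrete : Classes {Fin m} (λ _ _ → ⊥) m
discrete = record
  { class      = id
  ; surjective = λ i → i , id
  ; same-class = mk⇔ (λ { refl → ε }) (Eq.fold isEquivalence (λ ()))
  }

_≈[_,_]_ : Rel A 0ℓ → A → A → Rel A 0ℓ → Set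
R ≈[ a , b ] S = (R ⇒ EqClosure (S ∪ Edge a b)) × (S ⇒ EqClosure (R ∪ Edge a b))

module _ {a b : A} (R≈S : R ≈[ a , b ] S) where
  private
    f : R ∪ Edge a b ⇒ EqClosure (S ∪ Edge a b)
    f (inj₁ r) = proj₁ R≈S r
    f (inj₂ e) = Eq.return (inj₂ e)
    g : S ∪ Edge a b ⇒ EqClosure (R ∪ Edge a b)
    g (inj₁ r) = proj₂ R≈S r
    g (inj₂ e) = Eq.return (inj₂ e)

  ≈-related : EqClosure R a b → EqClosure S a b → EqClosure R ⇒ EqClosure S
  ≈-related r s = drop-edge s ∘ (f ⋆) ∘ ∪ˡ

  count-both : EqClosure R a b → EqClosure S a b → Classes R k → Classes S l → k ≡ l
  count-both r s c d = Classes-unique (add-related r c) (Classes-resp g f (add-related s d))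

  count-one : EqClosure R a b → ¬ EqClosure S a b → Classes R k → Classes S l → l ≡ suc k
  count-one {l = zero}  r ¬s c d = case Classes.class d a of λ ()
  count-one {l = suc l} r ¬s c d =
    cong suc (sym (Classes-unique (add-related r c) (Classes-resp g f (add-unrelated ¬s d))))

transpose-left : ∀ (a b : Fin m) → transpose a b a ≡ b
transpose-left a b with a ≟ a
... | yes _  = refl
... | no a≢a = contradiction refl a≢a

transpose-right : ∀ (a b : Fin m) → transpose a b b ≡ a
transpose-right a b with b ≟ a
... | yes b≡a = b≡a
... | no _ with b ≟ b
...   | yes _  = refl
...   | no b≢b = contradiction refl b≢b

transpose-other : ∀ {a b c : Fin m} → c ≢ a → c ≢ b → transpose a b c ≡ c
transpose-other {a = a} {b} {c} c≢a c≢b with c ≟ a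
... | yes c≡a = contradiction c≡a c≢a
... | no _ with c ≟ b
...   | yes c≡b = contradiction c≡b c≢b
...   | no _    = refl

data TransposeView {m} (a b : Fin m) : Fin m → Set where
  left  : TransposeView a b a
  right : TransposeView a b b
  other : ∀ {c} → c ≢ a → c ≢ b → TransposeView a b c

transposeView : ∀ (a b c : Fin m) → TransposeView a b c
transposeView a b c with c ≟ a | c ≟ b
... | yes refl | _        = left
... | no _     | yes refl = right
... | no c≢a   | no c≢b   = other c≢a c≢b

transpose-same : ∀ (a x : Fin m) → transpose a a x ≡ x
transpose-same a x with transposeView a a x
... | left      = transpose-left a a
... | right     = transpose-right a a
... | other p q = transpose-other p q

transpose-involutive : ∀ (a b c : Fin m) → transpose a b (transpose a b c) ≡ c
transpose-involutive a b c with transposeView a b c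
... | left = trans (cong (transpose a b) (transpose-left a b)) (transpose-right a b)
... | right = trans (cong (transpose a b) (transpose-right a b)) (transpose-left a b)
... | other c≢a c≢b = trans (cong (transpose a b) (transpose-other c≢a c≢b)) (transpose-other c≢a c≢b)

transpose-injective : ∀ (a b : Fin m) → Injective _≡_ _≡_ (transpose a b)
transpose-injective a b eq = trans (sym (transpose-involutive a b _))
  (trans (cong (transpose a b) eq) (transpose-involutive a b _))

transpose-natural : ∀ {f : Fin m → Fin n} → Injective _≡_ _≡_ f → ∀ a b c →
                    f (transpose a b c) ≡ transpose (f a) (f b) (f c)
transpose-natural {f = f} inj a b c with transposeView a b c
... | left = trans (cong f (transpose-left a b)) (sym (transpose-left (f a) (f b)))
... | right = trans (cong f (transpose-right a b)) (sym (transpose-right (f a) (f b)))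
... | other c≢a c≢b = trans (cong f (transpose-other c≢a c≢b))
                            (sym (transpose-other (c≢a ∘ inj) (c≢b ∘ inj)))

infixl 30 _[_⇄_]

_[_⇄_] : (Fin m → Fin m) → Fin m → Fin m → Fin m → Fin m
(f [ a ⇄ b ]) x = transpose a b (f x)

module _ {f : Fin m → Fin m} where
  ⇄-left : ∀ {a b x} → f x ≡ a → (f [ a ⇄ b ]) x ≡ b
  ⇄-left {a} {b} eq = trans (cong (transpose a b) eq) (transpose-left a b)

  ⇄-right : ∀ {a b x} → f x ≡ b → (f [ a ⇄ b ]) x ≡ a
  ⇄-right {a} {b} eq = trans (cong (transpose a b) eq) (transpose-right a b)

  ⇄-injective : ∀ {a b} → Injective _≡_ _≡_ f → Injective _≡_ _≡_ (f [ a ⇄ b ])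
  ⇄-injective inj = inj ∘ transpose-injective _ _

-- Orbits and transpositions

Orbit : (A → A) → Rel A 0ℓ
Orbit f = EqClosure (Graph f)

infix 30 _^[_]_

_^[_]_ : (A → A) → ℕ → A → A
f ^[ k ] x = fold x f k

next : ∀ {f : A → A} {x} → Orbit f x (f x)
next = Eq.return refl

iterate-orbit : ∀ (f : A → A) k x → Orbit f x (f ^[ k ] x)
iterate-orbit f zero    x = ε
iterate-orbit f (suc k) x = iterate-orbit f k x ◅◅ next

Orbit-resp : ∀ {f g : A → A} → f ≗ g → Orbit f ⇒ Orbit g
Orbit-resp f≗g = Eq.map λ eq → trans (sym (f≗g _)) eq

iterate-cong : ∀ {f g : A → A} → f ≗ g → ∀ k x → f ^[ k ] x ≡ g ^[ k ] x
iterate-cong         f≗g zero    x = refl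
iterate-cong {g = g} f≗g (suc k) x = trans (f≗g _) (cong g (iterate-cong f≗g k x))

iterate-+ : ∀ {f : A → A} k l x → f ^[ k + l ] x ≡ f ^[ k ] (f ^[ l ] x)
iterate-+ k l x = fold-+ x _ k

iterate-suc : ∀ {f : A → A} k x → f ^[ suc k ] x ≡ f ^[ k ] (f x)
iterate-suc zero    x = refl
iterate-suc {f = f} (suc k) x = cong f (iterate-suc k x)

least : ∀ {P : ℕ → Set} → (∀ i → Dec (P i)) → ∀ k → P k → ∃ λ i → P i × ∀ j → j < i → ¬ P j
least P? zero    p = zero , p , λ _ ()
least P? (suc k) p with P? zero
... | yes p₀ = zero , p₀ , λ _ ()
... | no ¬p₀ with i , pᵢ , min ← least (P? ∘ suc) k p =
  suc i , pᵢ , λ { zero _ → ¬p₀ ; (suc j) (s≤s j<i) → min j j<i }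

module _ {f : Fin m → Fin m} (inj : Injective _≡_ _≡_ f) where

  iterate-injective : ∀ k {x y} → f ^[ k ] x ≡ f ^[ k ] y → x ≡ y
  iterate-injective zero    eq = eq
  iterate-injective (suc k) eq = iterate-injective k (inj eq)

  period : ∀ x → ∃ λ t → f ^[ suc t ] x ≡ x
  period x with i , j , i<j , eq ← pigeonhole (ℕ.n<1+n m) (λ i → f ^[ toℕ i ] x)
           with t , p ← ℕ.m≤n⇒∃[o]m+o≡n i<j =
    t , sym (iterate-injective (toℕ i) (trans eq
      (trans (cong (f ^[_] x) (trans (sym p) (sym (ℕ.+-suc (toℕ i) t)))) (iterate-+ (toℕ i) (suc t) x))))

  orbit⇒iterate : ∀ {x y} → Orbit f x y → ∃ λ k → f ^[ k ] x ≡ y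
  orbit⇒iterate ε = 0 , refl
  orbit⇒iterate {x} (fwd refl ◅ r) with k , eq ← orbit⇒iterate r =
    suc k , trans (iterate-suc k x) eq
  orbit⇒iterate (bwd refl ◅ r)
    with k , eq ← orbit⇒iterate r | t , per ← period _ =
    k + t , trans (iterate-+ k t _) (trans (cong (f ^[ k ]_) (trans (sym (iterate-suc t _)) per)) eq)

  module _ {a b : Fin m} where
    private
      g : Fin m → Fin m
      g = f [ a ⇄ b ]

    ⇄-merges : ¬ Orbit f a b → Orbit g a b
    ⇄-merges ¬ab
      with t , per ← period b
      with t , per , min ← least (λ i → f ^[ suc i ] b ≟ b) t per =
      ~sym (subst (Orbit g b) (trans (cong (transpose a b ∘ f) (agree t ℕ.≤-refl)) (⇄-right {f = f} per))
              (iterate-orbit g (suc t) b))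
      where
      agree : ∀ i → i ≤ t → g ^[ i ] b ≡ f ^[ i ] b
      agree zero    _   = refl
      agree (suc i) i<t = trans (cong (transpose a b ∘ f) (agree i (ℕ.<⇒≤ i<t)))
        (transpose-other
          (λ eq → ¬ab (~sym (subst (Orbit f b) eq (iterate-orbit f (suc i) b))))
          (min i i<t))

module _ {f : Fin m → Fin m} (inj : Injective _≡_ _≡_ f) {a b : Fin m} where
  private
    g : Fin m → Fin m
    g = f [ a ⇄ b ]

  -- Until it reaches b, the f-orbit of a avoids a and b; then g closes it up.
  ⇄-splits : a ≢ b → Orbit f a b → ¬ Orbit g a b
  ⇄-splits a≢b ab ab′
    with k′ , eq′ ← orbit⇒iterate (⇄-injective {f = f} inj) ab′
    with orbit⇒iterate inj ab
  ... | zero  , eq = a≢b eq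
  ... | suc t , eq
    with t , eq , min ← least (λ i → f ^[ suc i ] a ≟ b) t eq = missed (arc-closed k′)
    where
    Arc : Fin m → Set
    Arc x = ∃ λ i → i ≤ t × x ≡ f ^[ i ] a

    no-return : ∀ i → i < t → f ^[ suc i ] a ≢ a
    no-return i i<t ret with u , refl ← ℕ.m≤n⇒∃[o]m+o≡n i<t =
      min u (s≤s (ℕ.m≤n+m u i)) (begin
        f ^[ suc u ] a                       ≡⟨ cong (f ^[ suc u ]_) ret ⟨
        f ^[ suc u ] (f ^[ suc i ] a)        ≡⟨ iterate-+ {f = f} (suc u) (suc i) a ⟨
        f ^[ suc u + suc i ] a               ≡⟨ cong (f ^[_] a) (ℕ.+-comm (suc u) (suc i)) ⟩
        f ^[ suc i + suc u ] a               ≡⟨ cong (f ^[_] a) (cong suc (ℕ.+-suc i u)) ⟩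
        f ^[ suc (suc i + u) ] a             ≡⟨ eq ⟩
        b                                    ∎)
      where open ≡-Reasoning

    arc-step : ∀ {x} → Arc x → Arc (g x)
    arc-step (i , i≤t , refl) with ℕ.m≤n⇒m<n∨m≡n i≤t
    ... | inj₁ i<t  = suc i , i<t , transpose-other (no-return i i<t) (min i i<t)
    ... | inj₂ refl = 0 , z≤n , ⇄-right {f = f} eq

    arc-closed : ∀ k → Arc (g ^[ k ] a)
    arc-closed zero    = 0 , z≤n , refl
    arc-closed (suc k) = arc-step (arc-closed k)

    missed : ¬ Arc (g ^[ k′ ] a)
    missed (zero  , _ , p)   = a≢b (sym (trans (sym eq′) p))
    missed (suc i , i<t , p) = min i i<t (trans (sym p) eq′)

opaque
  cyc-exists : ∀ (f : Fin m → Fin m) → ∃ (Classes (Graph f))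
  cyc-exists f = let (k , c) = add-graph discrete f in k ,
    Classes-resp (λ { (inj₁ ()) ; (inj₂ eq) → Eq.return eq }) (Eq.return ∘ inj₂) c

cyc : (Fin m → Fin m) → ℕ
cyc f = proj₁ (cyc-exists f)

cyc-classes : ∀ (f : Fin m → Fin m) → Classes (Graph f) (cyc f)
cyc-classes f = proj₂ (cyc-exists f)

orbit? : ∀ (f : Fin m → Fin m) x y → Dec (Orbit f x y)
orbit? f = ~? (cyc-classes f)

cyc-cong : ∀ {f g : Fin m → Fin m} → f ≗ g → cyc f ≡ cyc g
cyc-cong f≗g = Classes-unique (cyc-classes _)
  (Classes-resp (λ eq → Eq.return (trans (f≗g _) eq)) (λ eq → Eq.return (trans (sym (f≗g _)) eq)) (cyc-classes _))

classes-≤ : ∀ {R : Rel (Fin m) 0ℓ} → Classes R k → k ≤ m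
classes-≤ c = injective⇒≤ {f = representative c} λ eq →
  trans (sym (class-representative c _)) (trans (cong (Classes.class c) eq) (class-representative c _))

cyc-≤ : ∀ (f : Fin m → Fin m) → cyc f ≤ m
cyc-≤ f = classes-≤ (cyc-classes f)

cyc-id : ∀ {f : Fin m → Fin m} → f ≗ id → cyc f ≡ m
cyc-id f≗id = Classes-unique (cyc-classes _)
  (Classes-resp (λ ()) (λ { refl → subst (EqClosure _ _) (sym (f≗id _)) ε }) discrete)

transpose-edge : ∀ {a b : Fin m} x → EqClosure (R ∪ Edge a b) (transpose a b x) x
transpose-edge {R = R} {a = a} {b} x with transposeView a b x
... | left            = subst (λ y → EqClosure (R ∪ Edge a b) y a) (sym (transpose-left a b)) (~sym edge)
... | right           = subst (λ y → EqClosure (R ∪ Edge a b) y b) (sym (transpose-right a b)) edge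
... | other x≢a x≢b = subst (λ y → EqClosure (R ∪ Edge a b) y x) (sym (transpose-other x≢a x≢b)) ε

module _ (f : Fin m → Fin m) {a b : Fin m} where
  ⇄-graphˡ : Graph f ⇒ R → Graph (f [ a ⇄ b ]) ⇒ EqClosure (R ∪ Edge a b)
  ⇄-graphˡ inc refl = ∪ˡ (Eq.return (inc refl)) ◅◅ ~sym (transpose-edge (f _))

  ⇄-graphʳ : Graph (f [ a ⇄ b ]) ⇒ R → Graph f ⇒ EqClosure (R ∪ Edge a b)
  ⇄-graphʳ inc refl = ∪ˡ (Eq.return (inc refl)) ◅◅ transpose-edge (f _)

  ⇄-≈ : Graph f ≈[ a , b ] Graph (f [ a ⇄ b ])
  ⇄-≈ = ⇄-graphʳ id , ⇄-graphˡ id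

≈-sym : ∀ {a b : A} → R ≈[ a , b ] S → S ≈[ a , b ] R
≈-sym (f , g) = g , f

module _ {f : Fin m → Fin m} (inj : Injective _≡_ _≡_ f) {a b : Fin m} where
  cyc-split : a ≢ b → Orbit f a b → cyc (f [ a ⇄ b ]) ≡ suc (cyc f)
  cyc-split a≢b ab = count-one (⇄-≈ f) ab (⇄-splits inj a≢b ab) (cyc-classes f) (cyc-classes _)

  cyc-merge : ¬ Orbit f a b → cyc f ≡ suc (cyc (f [ a ⇄ b ]))
  cyc-merge ¬ab = count-one (≈-sym (⇄-≈ f)) (⇄-merges inj ¬ab) ¬ab (cyc-classes _) (cyc-classes f)

  cyc-⇄-≤ : cyc f ≤ suc (cyc (f [ a ⇄ b ]))
  cyc-⇄-≤ with orbit? f a b | a ≟ b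
  ... | no ¬ab | _ = ℕ.≤-reflexive (cyc-merge ¬ab)
  ... | yes ab | no a≢b = ℕ.m≤n⇒m≤1+n (ℕ.≤-trans (ℕ.n≤1+n _) (ℕ.≤-reflexive (sym (cyc-split a≢b ab))))
  ... | yes ab | yes refl = ℕ.m≤n⇒m≤1+n (ℕ.≤-reflexive (cyc-cong {f = f} λ x → sym (transpose-same a (f x))))

-- Euler's inequality

record State (m : ℕ) : Set where
  constructor state
  field
    σ α : Fin m → Fin m

  φ : Fin m → Fin m
  φ = σ ∘ α

  Linked : Rel (Fin m) 0ℓ
  Linked = Graph σ ∪ Graph α

  Connected : Rel (Fin m) 0ℓ
  Connected = EqClosure Linked

  orbit-σ : Orbit σ ⇒ Connected
  orbit-σ = ∪ˡ

  orbit-α : Orbit α ⇒ Connected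
  orbit-α = Eq.map inj₂

  orbit-φ : Orbit φ ⇒ Connected
  orbit-φ = (λ { refl → orbit-α next ◅◅ orbit-σ next }) ⋆

open State

opaque
  comp-exists : ∀ (s : State m) → ∃ (Classes (Linked s))
  comp-exists s = add-graph (cyc-classes (σ s)) (α s)

comp : State m → ℕ
comp s = proj₁ (comp-exists s)

comp-classes : ∀ (s : State m) → Classes (Linked s) (comp s)
comp-classes s = proj₂ (comp-exists s)

σ⇄ α⇄ : Fin m → Fin m → State m → State m
σ⇄ a b s = state (σ s [ a ⇄ b ]) (α s)
α⇄ a b s = state (σ s) (α s [ a ⇄ b ])

module _ (s : State m) {a b : Fin m} where
  σ⇄-linked : Linked s ≈[ a , b ] Linked (σ⇄ a b s)
  σ⇄-linked = (λ { (inj₁ e) → ⇄-graphʳ (σ s) inj₁ e ; (inj₂ e) → Eq.return (inj₁ (inj₂ e)) })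
            , (λ { (inj₁ e) → ⇄-graphˡ (σ s) inj₁ e ; (inj₂ e) → Eq.return (inj₁ (inj₂ e)) })

  α⇄-linked : Linked s ≈[ a , b ] Linked (α⇄ a b s)
  α⇄-linked = (λ { (inj₂ e) → ⇄-graphʳ (α s) inj₂ e ; (inj₁ e) → Eq.return (inj₁ (inj₁ e)) })
            , (λ { (inj₂ e) → ⇄-graphˡ (α s) inj₂ e ; (inj₁ e) → Eq.return (inj₁ (inj₁ e)) })

  φ-α⇄ : Injective _≡_ _≡_ (σ s) → φ (α⇄ a b s) ≗ φ s [ σ s a ⇄ σ s b ]
  φ-α⇄ inj x = transpose-natural inj a b (α s x)

-- For arbitrary permutations of m darts, Euler's formula counts the orbits of
-- α as well: V + F + A = m + 2 C, where C is the number of components.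
χ : State m → ℕ
χ s = cyc (σ s) + cyc (φ s) + cyc (α s)

-- Equality holds for α = id, and each transposition split off α does not
-- increase m + 2 C - χ.
euler-≤ : ∀ (s : State m) → Injective _≡_ _≡_ (σ s) → Injective _≡_ _≡_ (α s) → χ s ≤ m + 2 * comp s
euler-≤ {m} s σ-inj = go (m ∸ cyc (α s)) (α s) (ℕ.≤-reflexive (sym (ℕ.m∸n+n≡m (cyc-≤ (α s)))))
  where
  go : ∀ d a → m ≤ d + cyc a → Injective _≡_ _≡_ a →
       χ (state (σ s) a) ≤ m + 2 * comp (state (σ s) a)
  go d a m≤ inj with any? (λ i → ¬? (a i ≟ i))
  ... | no ¬moved = ℕ.≤-reflexive (trans (cong₂ _+_ (cong (λ c → cyc (σ s) + c) φ≡) (cyc-id fixed))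
                      (trans (arith (cyc (σ s)) m) (cong (λ c → m + 2 * c) comp≡)))
    where
    t = state (σ s) a
    fixed : a ≗ id
    fixed i = decidable-stable (a i ≟ i) (λ p → ¬moved (i , p))
    φ≡ : cyc (φ t) ≡ cyc (σ s)
    φ≡ = cyc-cong (cong (σ s) ∘ fixed)
    comp≡ : cyc (σ s) ≡ comp t
    comp≡ = Classes-unique (Classes-resp (Eq.return ∘ inj₁)
      (λ { (inj₁ e) → Eq.return e ; (inj₂ refl) → subst (EqClosure _ _) (sym (fixed _)) ε })
      (cyc-classes (σ s))) (comp-classes t)
    arith : ∀ v m → v + v + m ≡ m + 2 * v
    arith = solve-∀
  ... | yes (i , ai≢i) = step d m≤
    where
    t t′ : State m
    t = state (σ s) a
    t′ = α⇄ i (a i) t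
    E≡ : cyc (α t′) ≡ suc (cyc a)
    E≡ = cyc-split inj (ai≢i ∘ sym) next
    φ-inj : Injective _≡_ _≡_ (φ t′)
    φ-inj = ⇄-injective {f = a} inj ∘ σ-inj
    φ-inj₀ : Injective _≡_ _≡_ (φ t)
    φ-inj₀ = inj ∘ σ-inj
    F≡ : cyc (φ t′) ≡ cyc (φ t [ σ s i ⇄ σ s (a i) ])
    F≡ = cyc-cong (φ-α⇄ t σ-inj)
    open ℕ.≤-Reasoning
    step : ∀ d → m ≤ d + cyc a → χ t ≤ m + 2 * comp t
    step zero    m≤a = contradiction (ℕ.≤-trans (ℕ.≤-reflexive (sym E≡)) (ℕ.≤-trans (cyc-≤ (α t′)) m≤a)) ℕ.1+n≰n
    step (suc d) m≤ with ~? (comp-classes t′) i (a i)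
    ... | yes r = begin
        V + F + E            ≤⟨ ℕ.+-monoˡ-≤ E (ℕ.+-monoʳ-≤ V (cyc-⇄-≤ φ-inj₀)) ⟩
        V + suc F″ + E       ≡⟨ arith V F″ E ⟩
        V + F″ + suc E       ≡⟨ cong₂ (λ x y → V + x + y) (sym F≡) (sym E≡) ⟩
        χ t′                 ≤⟨ ih ⟩
        m + 2 * comp t′      ≡⟨ cong (λ c → m + 2 * c) C≡ ⟨
        m + 2 * comp t       ∎
      where
      V = cyc (σ s)
      F = cyc (φ t)
      F″ = cyc (φ t [ σ s i ⇄ σ s (a i) ])
      E = cyc a
      ih : χ t′ ≤ m + 2 * comp t′
      ih = go d (α t′) (ℕ.≤-trans m≤ (ℕ.≤-reflexive (trans (sym (ℕ.+-suc d E)) (cong (λ c → d + c) (sym E≡)))))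
            (⇄-injective {f = a} inj)
      C≡ : comp t ≡ comp t′
      C≡ = count-both (α⇄-linked t) (orbit-α t next) r (comp-classes t) (comp-classes t′)
      arith : ∀ v f a → v + suc f + a ≡ v + f + suc a
      arith = solve-∀
    ... | no ¬r = ℕ.+-cancelˡ-≤ 2 _ _ (begin
        2 + (V + F + E)      ≡⟨ arith V F E ⟩
        V + suc F + suc E    ≡⟨ cong₂ (λ x y → V + x + y) (sym F′≡) (sym E≡) ⟩
        χ t′                 ≤⟨ ih ⟩
        m + 2 * comp t′      ≡⟨ cong (λ c → m + 2 * c) C≡ ⟩
        m + 2 * suc (comp t) ≡⟨ arith′ m (comp t) ⟩
        2 + (m + 2 * comp t) ∎)
      where
      V = cyc (σ s)
      F = cyc (φ t)
      E = cyc a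
      ih : χ t′ ≤ m + 2 * comp t′
      ih = go d (α t′) (ℕ.≤-trans m≤ (ℕ.≤-reflexive (trans (sym (ℕ.+-suc d E)) (cong (λ c → d + c) (sym E≡)))))
            (⇄-injective {f = a} inj)
      C≡ : comp t′ ≡ suc (comp t)
      C≡ = count-one (α⇄-linked t) (orbit-α t next) ¬r (comp-classes t) (comp-classes t′)
      separate : ¬ Orbit (φ t′) (σ s i) (σ s (a i))
      separate r = ¬r (orbit-σ t′ next ◅◅ orbit-φ t′ r ◅◅ ~sym (orbit-σ t′ next))
      F′≡ : cyc (φ t′) ≡ suc F
      F′≡ = trans (cyc-merge φ-inj separate) (cong suc (cyc-cong λ x →
        trans (cong (transpose _ _) (φ-α⇄ t σ-inj x)) (transpose-involutive _ _ (φ t x))))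
      arith : ∀ v f a → 2 + (v + f + a) ≡ v + suc f + suc a
      arith = solve-∀
      arith′ : ∀ m c → m + 2 * suc c ≡ 2 + (m + 2 * c)
      arith′ = solve-∀

cong-edge : ∀ {a b : A} {d e} → EqClosure (R ∪ Edge a b) d e →
            EqClosure R d e ⊎ ((EqClosure R d a ⊎ EqClosure R d b) × (EqClosure R e a ⊎ EqClosure R e b))
cong-edge {R = R} {a} {b} = Eq.fold equivalence λ
  { (inj₁ r) → inj₁ (Eq.return r) ; (inj₂ (refl , refl)) → inj₂ (inj₁ ε , inj₂ ε) }
  where
  Near : _ → Set
  Near d = EqClosure R d a ⊎ EqClosure R d b
  near : ∀ {d e} → EqClosure R d e → Near e → Near d
  near r (inj₁ s) = inj₁ (r ◅◅ s)
  near r (inj₂ s) = inj₂ (r ◅◅ s)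
  equivalence : IsEquivalence (λ d e → EqClosure R d e ⊎ (Near d × Near e))
  equivalence = record
    { refl  = inj₁ ε
    ; sym   = λ { (inj₁ r) → inj₁ (~sym r) ; (inj₂ (p , q)) → inj₂ (q , p) }
    ; trans = λ { (inj₁ r) (inj₁ s) → inj₁ (r ◅◅ s)
                ; (inj₁ r) (inj₂ (p , q)) → inj₂ (near r p , q)
                ; (inj₂ (p , q)) (inj₁ s) → inj₂ (p , near (~sym s) q)
                ; (inj₂ (p , _)) (inj₂ (_ , q)) → inj₂ (p , q) }
    }

≈-⊆ : ∀ {a b : A} → R ≈[ a , b ] S → EqClosure R ⇒ EqClosure (S ∪ Edge a b)
≈-⊆ (f , _) = f ⋆

-- Counting the orbits that meet a set

record Count {A : Set} (f : A → A) (P : A → Set) (k : ℕ) : Set where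
  field
    point        : Fin k → A
    point-in     : ∀ i → P (point i)
    point-unique : ∀ i j → Orbit f (point i) (point j) → i ≡ j
    cover        : ∀ d → P d → ∃ λ i → Orbit f d (point i)

Count-≤ : ∀ {f : A → A} {g : B → B} {P Q} (h : A → B) →
          (∀ {d} → P d → Q (h d)) →
          (∀ {d e} → P d → P e → Orbit g (h d) (h e) → Orbit f d e) →
          Count f P k → Count g Q l → k ≤ l
Count-≤ {f = f} {g} h in-Q reflect c d = injective⇒≤ {f = λ i → proj₁ (meet i)} λ {i} {j} eq →
  C.point-unique i j (reflect (C.point-in i) (C.point-in j)
    (proj₂ (meet i) ◅◅ subst (λ t → Orbit g (D.point t) (h (C.point j))) (sym eq) (~sym (proj₂ (meet j)))))
  where
  module C = Count c
  module D = Count d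
  meet : ∀ i → ∃ λ t → Orbit g (h (C.point i)) (D.point t)
  meet i = D.cover _ (in-Q (C.point-in i))

Count-unique : ∀ {f : A → A} {P} → Count f P k → Count f P l → k ≡ l
Count-unique c d = ℕ.≤-antisym (Count-≤ id id (λ _ _ → id) c d) (Count-≤ id id (λ _ _ → id) d c)

Count-map : ∀ {f : A → A} {g : B → B} {P Q} (h : A → B) →
            (∀ {d} → P d → Q (h d)) →
            (∀ {d e} → P d → P e → Orbit f d e → Orbit g (h d) (h e)) →
            (∀ {d e} → P d → P e → Orbit g (h d) (h e) → Orbit f d e) →
            (∀ {e} → Q e → ∃ λ d → P d × Orbit g e (h d)) →
            Count f P k → Count g Q k
Count-map h in-Q preserve reflect onto c = record
  { point        = h ∘ point
  ; point-in     = in-Q ∘ point-in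
  ; point-unique = λ i j → point-unique i j ∘ reflect (point-in i) (point-in j)
  ; cover        = λ e q → let (d , p , r) = onto q ; (i , r′) = cover d p
                           in i , r ◅◅ preserve p (point-in i) r′
  }
  where open Count c

Count-⊎ : ∀ {f : A → A} {P Q : A → Set} → (∀ {d e} → P d → Q e → ¬ Orbit f d e) →
          Count f P k → Count f Q l → Count f (λ d → P d ⊎ Q d) (k + l)
Count-⊎ {k = k} {l = l} {f = f} {P} {Q} apart c d = record
  { point        = pt ∘ splitAt k
  ; point-in     = λ i → pt-in (splitAt k i)
  ; point-unique = λ i j r → trans (sym (join-splitAt k l i))
                     (trans (cong (join k l) (pt-unique (splitAt k i) (splitAt k j) r)) (join-splitAt k l j))
  ; cover        = λ { e (inj₁ p) → let (i , r) = C.cover e p in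
                         i ↑ˡ l , subst (λ t → Orbit f e (pt t)) (sym (splitAt-↑ˡ k i l)) r
                     ; e (inj₂ q) → let (i , r) = D.cover e q in
                         k ↑ʳ i , subst (λ t → Orbit f e (pt t)) (sym (splitAt-↑ʳ k l i)) r }
  }
  where
  module C = Count c
  module D = Count d
  pt : Fin k ⊎ Fin l → _
  pt = [ C.point , D.point ]′
  pt-in : ∀ t → P (pt t) ⊎ Q (pt t)
  pt-in (inj₁ i) = inj₁ (C.point-in i)
  pt-in (inj₂ i) = inj₂ (D.point-in i)
  pt-unique : ∀ t u → Orbit f (pt t) (pt u) → t ≡ u
  pt-unique (inj₁ i) (inj₁ j) r = cong inj₁ (C.point-unique i j r)
  pt-unique (inj₁ i) (inj₂ j) r = contradiction r (apart (C.point-in i) (D.point-in j))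
  pt-unique (inj₂ i) (inj₁ j) r = contradiction (~sym r) (apart (C.point-in j) (D.point-in i))
  pt-unique (inj₂ i) (inj₂ j) r = cong inj₂ (D.point-unique i j r)

Count-∅ : ∀ {f : A → A} {P} → (∀ {d} → ¬ P d) → Count f P 0
Count-∅ ¬p = record
  { point = λ () ; point-in = λ () ; point-unique = λ () ; cover = λ _ p → contradiction p ¬p }

Count-≡ : ∀ {f : A → A} a → Count f (_≡ a) 1
Count-≡ a = record
  { point        = λ _ → a
  ; point-in     = λ _ → refl
  ; point-unique = λ { zero zero _ → refl }
  ; cover        = λ { _ refl → zero , ε }
  }

Prefix : (ℕ → A) → ℕ → A → Set
Prefix w j d = ∃ λ i → i < j × d ≡ w i

New : (A → A) → (ℕ → A) → ℕ → Set
New f w j = ∀ i → i < j → ¬ Orbit f (w i) (w j)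

module _ {f : Fin m → Fin m} {w : ℕ → Fin m} where

  count-new : ∀ {j} → New f w j → Count f (Prefix w j) k → Count f (Prefix w (suc j)) (suc k)
  count-new {k = k} {j} new c = subst (Count f _) (ℕ.+-comm k 1)
    (Count-map id
      (λ { (inj₁ (i , i<j , eq)) → i , ℕ.m<n⇒m<1+n i<j , eq ; (inj₂ eq) → j , ℕ.≤-refl , eq })
      (λ _ _ → id) (λ _ _ → id)
      (λ { (i , s≤s i≤j , refl) → case ℕ.m≤n⇒m<n∨m≡n i≤j of λ
             { (inj₁ i<j) → w i , inj₁ (i , i<j , refl) , ε
             ; (inj₂ refl) → w i , inj₂ refl , ε } })
      (Count-⊎ (λ { (i , i<j , refl) refl → new i i<j }) c (Count-≡ (w j))))

  count-old : ∀ {j} i → i < j → Orbit f (w i) (w j) → Count f (Prefix w j) k → Count f (Prefix w (suc j)) k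
  count-old {j = j} i i<j r = Count-map id
    (λ { (i , i<j , eq) → i , ℕ.m<n⇒m<1+n i<j , eq })
    (λ _ _ → id) (λ _ _ → id)
    (λ { (i′ , s≤s i′≤j , refl) → case ℕ.m≤n⇒m<n∨m≡n i′≤j of λ
           { (inj₁ i′<j) → w i′ , (i′ , i′<j , refl) , ε
           ; (inj₂ refl) → w i , (i , i<j , refl) , ~sym r } })

  new? : ∀ j → New f w j ⊎ ∃ λ i → i < j × Orbit f (w i) (w j)
  new? j with ℕ.anyUpTo? (λ i → orbit? f (w i) (w j)) j
  ... | yes (i , i<j , r) = inj₂ (i , i<j , r)
  ... | no ¬old           = inj₁ λ i i<j r → ¬old (i , i<j , r)

  count-prefix : ∀ j → ∃ (Count f (Prefix w j))
  count-prefix zero    = 0 , Count-∅ λ { (_ , () , _) }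
  count-prefix (suc j) with k , c ← count-prefix j | new? j
  ... | inj₁ new           = suc k , count-new new c
  ... | inj₂ (i , i<j , r) = k , count-old i i<j r c

  first-visit : ∀ ℓ J → (∃ λ j → j < J × New f w j × Count f (Prefix w j) ℓ) ⊎
                        (∃ λ c → c ≤ ℓ × Count f (Prefix w J) c)
  first-visit ℓ zero    = inj₂ (0 , z≤n , proj₂ (count-prefix 0))
  first-visit ℓ (suc J) with first-visit ℓ J
  ... | inj₁ (j , j<J , found) = inj₁ (j , ℕ.m<n⇒m<1+n j<J , found)
  ... | inj₂ (c , c≤ℓ , cnt) with new? J | ℕ.m≤n⇒m<n∨m≡n c≤ℓ
  ...   | inj₂ (i , i<J , r) | _         = inj₂ (c , c≤ℓ , count-old i i<J r cnt)
  ...   | inj₁ new           | inj₁ c<ℓ  = inj₂ (suc c , c<ℓ , count-new new cnt)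
  ...   | inj₁ new           | inj₂ refl = inj₁ (J , ℕ.≤-refl , new , cnt)

  first-visit-unique : ∀ {ℓ j j′} → New f w j → Count f (Prefix w j) ℓ →
                       New f w j′ → Count f (Prefix w j′) ℓ → j ≡ j′
  first-visit-unique {j = j} {j′} new c new′ c′ =
    ℕ.≤-antisym (ℕ.≮⇒≥ (too-many new′ c′ c)) (ℕ.≮⇒≥ (too-many new c c′))
    where
    too-many : ∀ {ℓ j j′} → New f w j → Count f (Prefix w j) ℓ → Count f (Prefix w j′) ℓ → ¬ j < j′
    too-many new c c′ j<j′ = ℕ.1+n≰n (Count-≤ id
      (λ { (i , i<j , eq) → i , ℕ.<-≤-trans i<j j<j′ , eq }) (λ _ _ → id) (count-new new c) c′)

iterate-agree : ∀ {f g : A → A} {y} j → (∀ i → i < j → f (f ^[ i ] y) ≡ g (f ^[ i ] y)) →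
                ∀ i → i ≤ j → f ^[ i ] y ≡ g ^[ i ] y
iterate-agree         j agree zero    _   = refl
iterate-agree {g = g} j agree (suc i) i<j =
  trans (agree i i<j) (cong g (iterate-agree j agree i (ℕ.<⇒≤ i<j)))

orbit-closed : ∀ {f : Fin m → Fin m} {C : Fin m → Set} → Injective _≡_ _≡_ f →
               (∀ {d} → C d → C (f d)) → ∀ {d e} → C d → Orbit f d e → C e
orbit-closed {f = f} {C} inj closed {d} c r with k , refl ← orbit⇒iterate inj r = go k
  where
  go : ∀ k → C (f ^[ k ] d)
  go zero    = c
  go (suc k) = closed (go k)

orbit-local : ∀ {f g : Fin m → Fin m} (C : Fin m → Set) → Injective _≡_ _≡_ f →
              (∀ {d} → C d → C (f d)) → (∀ {d} → C d → f d ≡ g d) →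
              ∀ {d e} → C d → Orbit f d e → Orbit g d e
orbit-local {f = f} {g} C inj closed agree {d} c r = proj₂ (orbit-closed
  {C = λ e → C e × Orbit g d e} inj
  (λ { (c , r) → closed c , r ◅◅ Eq.return (sym (agree c)) }) (c , ε) r)

-- Planar states

infix 4 _≗ₛ_
_≗ₛ_ : State m → State m → Set
s ≗ₛ t = (σ s ≗ σ t) × (α s ≗ α t)

Linked-resp : ∀ {s t : State m} → s ≗ₛ t → Linked s ⇒ Linked t
Linked-resp (p , q) (inj₁ e) = inj₁ (trans (sym (p _)) e)
Linked-resp (p , q) (inj₂ e) = inj₂ (trans (sym (q _)) e)

≗ₛ-sym : ∀ {s t : State m} → s ≗ₛ t → t ≗ₛ s
≗ₛ-sym (p , q) = (λ x → sym (p x)) , (λ x → sym (q x))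

φ-resp : ∀ {s t : State m} → s ≗ₛ t → φ s ≗ φ t
φ-resp {t = t} (p , q) x = trans (p _) (cong (σ t) (q x))

record Planar {m} (s : State m) : Set where
  field
    σ-injective  : Injective _≡_ _≡_ (σ s)
    α-involutive : ∀ d → α s (α s d) ≡ d
    euler        : χ s ≡ m + 2 * comp s

  α-injective : Injective _≡_ _≡_ (α s)
  α-injective eq = trans (sym (α-involutive _)) (trans (cong (α s) eq) (α-involutive _))

  φ-injective : Injective _≡_ _≡_ (φ s)
  φ-injective = α-injective ∘ σ-injective

open Planar

Planar-resp : ∀ {s t : State m} → s ≗ₛ t → Planar s → Planar t
Planar-resp {m = m} {s = s} {t} eq@(p , q) P = record
  { σ-injective  = λ e → σ-injective P (trans (p _) (trans e (sym (p _))))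
  ; α-involutive = λ d → trans (sym (trans (q _) (cong (α t) (q d)))) (α-involutive P d)
  ; euler        = trans (cong₂ _+_ (cong₂ _+_ (cyc-cong (sym ∘ p)) (cyc-cong (sym ∘ φ-resp eq))) (cyc-cong (sym ∘ q)))
                     (trans (euler P) (cong (λ c → m + 2 * c)
                       (Classes-unique (comp-classes s)
                         (Classes-resp (Eq.return ∘ Linked-resp (≗ₛ-sym eq)) (Eq.return ∘ Linked-resp eq) (comp-classes t)))))
  }

α⇄-involutive : ∀ {s : State m} {y z} → (∀ d → α s (α s d) ≡ d) →
                (α s y ≡ z × α s z ≡ y) ⊎ (α s y ≡ y × α s z ≡ z) → ∀ d → α (α⇄ y z s) (α (α⇄ y z s) d) ≡ d
α⇄-involutive {s = s} {y} {z} inv yz d = begin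
  transpose y z (α s (transpose y z (α s d)))     ≡⟨ cong (transpose y z) (commutes (α s d) yz) ⟩
  transpose y z (transpose y z (α s (α s d)))     ≡⟨ transpose-involutive y z _ ⟩
  α s (α s d)                                     ≡⟨ inv d ⟩
  d                                               ∎
  where
  open ≡-Reasoning
  inj : Injective _≡_ _≡_ (α s)
  inj eq = trans (sym (inv _)) (trans (cong (α s) eq) (inv _))
  transpose-comm : ∀ c → transpose z y c ≡ transpose y z c
  transpose-comm c with transposeView y z c
  ... | left      = trans (transpose-right z y) (sym (transpose-left y z))
  ... | right     = trans (transpose-left z y) (sym (transpose-right y z))
  ... | other p q = trans (transpose-other q p) (sym (transpose-other p q))
  commutes : ∀ c → (α s y ≡ z × α s z ≡ y) ⊎ (α s y ≡ y × α s z ≡ z) → α s (transpose y z c) ≡ transpose y z (α s c)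
  commutes c (inj₁ (p , q)) = trans (transpose-natural inj y z c)
    (trans (cong₂ (λ a b → transpose a b (α s c)) p q) (transpose-comm (α s c)))
  commutes c (inj₂ (p , q)) = trans (transpose-natural inj y z c)
    (cong₂ (λ a b → transpose a b (α s c)) p q)

module _ {s : State m} (P : Planar s) where
  private
    balance : ∀ (t : State m) → χ t + 2 * comp s ≡ χ s + 2 * comp t → χ t ≡ m + 2 * comp t
    balance t eq = ℕ.+-cancelʳ-≡ (2 * comp s) _ _ (begin
      χ t + 2 * comp s                 ≡⟨ eq ⟩
      χ s + 2 * comp t                 ≡⟨ cong (_+ 2 * comp t) (euler P) ⟩
      m + 2 * comp s + 2 * comp t      ≡⟨ arith m (2 * comp s) (2 * comp t) ⟩
      m + 2 * comp t + 2 * comp s      ∎)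
      where
      open ≡-Reasoning
      arith : ∀ m c d → m + c + d ≡ m + d + c
      arith = solve-∀

    overfull : ∀ (t : State m) → χ t ≤ m + 2 * comp t → χ t ≡ 2 + χ s → comp s ≢ comp t
    overfull t le eq C≡ = ℕ.1+n≰n (ℕ.≤-trans (ℕ.n≤1+n _) (begin
      2 + χ s          ≡⟨ eq ⟨
      χ t              ≤⟨ le ⟩
      m + 2 * comp t   ≡⟨ cong (λ c → m + 2 * c) C≡ ⟨
      m + 2 * comp s   ≡⟨ euler P ⟨
      χ s              ∎))
      where open ℕ.≤-Reasoning

    planar-σ : ∀ {a b} → cyc (σ s [ a ⇄ b ]) + cyc (φ s [ a ⇄ b ]) + cyc (α s) ≡ m + 2 * comp (σ⇄ a b s) →
               Planar (σ⇄ a b s)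
    planar-σ eq = record
      { σ-injective = ⇄-injective {f = σ s} (σ-injective P) ; α-involutive = α-involutive P ; euler = eq }

  planar-split-vertex : ∀ {x q} → x ≢ q → Orbit (σ s) x q → Connected (σ⇄ x q s) x q →
                        ¬ Orbit (φ s) x q × Planar (σ⇄ x q s)
  planar-split-vertex {x} {q} x≢q xq linked = ¬φ ,
    planar-σ (balance (σ⇄ x q s) (cong₂ _+_ (arith (cyc (α s)) V≡ (cyc-merge (φ-injective P) ¬φ)) (cong (2 *_) C≡)))
    where
    V≡ = cyc-split (σ-injective P) x≢q xq
    C≡ : comp s ≡ comp (σ⇄ x q s)
    C≡ = count-both (σ⇄-linked s) (orbit-σ s xq) linked (comp-classes s) (comp-classes (σ⇄ x q s))
    ¬φ : ¬ Orbit (φ s) x q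
    ¬φ r = overfull (σ⇄ x q s) (euler-≤ (σ⇄ x q s) (⇄-injective {f = σ s} (σ-injective P)) (α-injective P))
      (cong (_+ cyc (α s)) (trans (cong₂ _+_ V≡ (cyc-split (φ-injective P) x≢q r)) (cong suc (ℕ.+-suc _ _)))) C≡
    arith : ∀ {v f v′ f′} a → v′ ≡ suc v → f ≡ suc f′ → v′ + f′ + a ≡ v + f + a
    arith {v} {f′ = f′} a refl refl = cong (_+ a) (sym (ℕ.+-suc v f′))

  planar-merge-vertex : ∀ {x q} → ¬ Orbit (σ s) x q → Orbit (φ s) x q → Planar (σ⇄ x q s)
  planar-merge-vertex {x} {q} ¬σ r = planar-σ (balance (σ⇄ x q s)
      (cong₂ _+_ (arith (cyc (α s)) (cyc-merge (σ-injective P) ¬σ) (cyc-split (φ-injective P) x≢q r)) (cong (2 *_) C≡)))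
    where
    x≢q : x ≢ q
    x≢q refl = ¬σ ε
    C≡ : comp s ≡ comp (σ⇄ x q s)
    C≡ = count-both (σ⇄-linked s) (orbit-φ s r) (orbit-σ (σ⇄ x q s) (⇄-merges (σ-injective P) ¬σ))
           (comp-classes s) (comp-classes (σ⇄ x q s))
    arith : ∀ {v f v′ f′} a → v ≡ suc v′ → f′ ≡ suc f → v′ + f′ + a ≡ v + f + a
    arith {f = f} {v′} a refl refl = cong (_+ a) (ℕ.+-suc v′ f)

  planar-join : ∀ {p y} → ¬ Connected s p y → Planar (σ⇄ p y s)
  planar-join {p} {y} ¬py = planar-σ (balance (σ⇄ p y s)
      (arith (cyc (α s)) (cyc-merge (σ-injective P) ¬σ) (cyc-merge (φ-injective P) (¬py ∘ orbit-φ s)) C≡))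
    where
    ¬σ : ¬ Orbit (σ s) p y
    ¬σ = ¬py ∘ orbit-σ s
    C≡ : comp s ≡ suc (comp (σ⇄ p y s))
    C≡ = count-one (≈-sym (σ⇄-linked s)) (orbit-σ (σ⇄ p y s) (⇄-merges (σ-injective P) ¬σ)) ¬py
           (comp-classes (σ⇄ p y s)) (comp-classes s)
    arith : ∀ {v f c v′ f′ c′} a → v ≡ suc v′ → f ≡ suc f′ → c ≡ suc c′ →
            v′ + f′ + a + 2 * c ≡ v + f + a + 2 * c′
    arith {v′ = v′} {f′} {c′} a refl refl refl = lemma v′ f′ a c′
      where
      lemma : ∀ v f a c → v + f + a + 2 * suc c ≡ suc v + suc f + a + 2 * c
      lemma = solve-∀

  planar-detach : ∀ {p y} → p ≢ y → α s p ≡ p → σ s p ≡ y → ¬ Connected (σ⇄ p y s) p y → Planar (σ⇄ p y s)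
  planar-detach {p} {y} p≢y αp σp ¬py = planar-σ (balance (σ⇄ p y s)
      (arith (cyc (α s)) (cyc-split (σ-injective P) p≢y (Eq.return σp))
             (cyc-split (φ-injective P) p≢y (Eq.return (trans (cong (σ s) αp) σp))) C≡))
    where
    C≡ : comp (σ⇄ p y s) ≡ suc (comp s)
    C≡ = count-one (σ⇄-linked s) (orbit-σ s (Eq.return σp)) ¬py (comp-classes s) (comp-classes (σ⇄ p y s))
    arith : ∀ {v f c v′ f′ c′} a → v′ ≡ suc v → f′ ≡ suc f → c′ ≡ suc c →
            v′ + f′ + a + 2 * c ≡ v + f + a + 2 * c′
    arith {v} {f} {c} a refl refl refl = lemma v f a c
      where
      lemma : ∀ v f a c → suc v + suc f + a + 2 * c ≡ v + f + a + 2 * suc c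
      lemma = solve-∀

  planar-cut-edge : ∀ {y z} → y ≢ z → α s y ≡ z → Orbit (φ s) y z →
                    Planar (α⇄ y z s) × ¬ Connected (α⇄ y z s) y z
  planar-cut-edge {y} {z} y≢z αy r = record
      { σ-injective  = σ-injective P
      ; α-involutive = α⇄-involutive {s = s} (α-involutive P) (inj₁ (αy , αz))
      ; euler        = balance (α⇄ y z s) (arith (cyc (σ s)) F≡ A≡
          (count-one (α⇄-linked s) (orbit-α s (Eq.return αy)) ¬yz (comp-classes s) (comp-classes (α⇄ y z s))))
      } , ¬yz
    where
    αz : α s z ≡ y
    αz = trans (cong (α s) (sym αy)) (α-involutive P y)
    A≡ : cyc (α s [ y ⇄ z ]) ≡ suc (cyc (α s))
    A≡ = cyc-split (α-injective P) y≢z (Eq.return αy)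
    σσ : Orbit (φ s) (σ s y) (σ s z)
    σσ = ~sym (Eq.return (cong (σ s) αz)) ◅◅ ~sym r ◅◅ Eq.return (cong (σ s) αy)
    F≡ : cyc (φ (α⇄ y z s)) ≡ suc (cyc (φ s))
    F≡ = trans (cyc-cong (φ-α⇄ s (σ-injective P))) (cyc-split (φ-injective P) (y≢z ∘ σ-injective P) σσ)
    ¬yz : ¬ Connected (α⇄ y z s) y z
    ¬yz yz = overfull (α⇄ y z s)
      (euler-≤ (α⇄ y z s) (σ-injective P) (⇄-injective {f = α s} (α-injective P)))
      (trans (cong₂ _+_ (cong (λ c → cyc (σ s) + c) F≡) A≡) (lemma (cyc (σ s)) (cyc (φ s)) (cyc (α s))))
      (count-both (α⇄-linked s) (orbit-α s (Eq.return αy)) yz (comp-classes s) (comp-classes (α⇄ y z s)))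
      where
      lemma : ∀ v f a → v + suc f + suc a ≡ 2 + (v + f + a)
      lemma = solve-∀
    arith : ∀ {f a c f′ a′ c′} v → f′ ≡ suc f → a′ ≡ suc a → c′ ≡ suc c →
            v + f′ + a′ + 2 * c ≡ v + f + a + 2 * c′
    arith {f} {a} {c} v refl refl refl = lemma v f a c
      where
      lemma : ∀ v f a c → v + suc f + suc a + 2 * c ≡ v + f + a + 2 * suc c
      lemma = solve-∀

  planar-add-edge : ∀ {y z} → α s y ≡ y → α s z ≡ z → ¬ Connected s y z → Planar (α⇄ y z s)
  planar-add-edge {y} {z} αy αz ¬yz = record
    { σ-injective  = σ-injective P
    ; α-involutive = α⇄-involutive {s = s} (α-involutive P) (inj₂ (αy , αz))
    ; euler        = balance (α⇄ y z s) (arith (cyc (σ s)) F≡ (cyc-merge (α-injective P) ¬α)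
        (count-one (≈-sym (α⇄-linked s)) (orbit-α (α⇄ y z s) (⇄-merges (α-injective P) ¬α)) ¬yz
          (comp-classes (α⇄ y z s)) (comp-classes s)))
    }
    where
    ¬α : ¬ Orbit (α s) y z
    ¬α = ¬yz ∘ orbit-α s
    F≡ : cyc (φ s) ≡ suc (cyc (φ (α⇄ y z s)))
    F≡ = trans (cyc-merge (φ-injective P) {a = σ s y} {b = σ s z}
        (λ r → ¬yz (orbit-σ s next ◅◅ orbit-φ s r ◅◅ ~sym (orbit-σ s next))))
      (cong suc (cyc-cong (λ x → sym (φ-α⇄ s (σ-injective P) x))))
    arith : ∀ {f a c f′ a′ c′} v → f ≡ suc f′ → a ≡ suc a′ → c ≡ suc c′ →
            v + f′ + a′ + 2 * c ≡ v + f + a + 2 * c′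
    arith {f′ = f} {a} {c} v refl refl refl = lemma v f a c
      where
      lemma : ∀ v f a c → v + f + a + 2 * suc c ≡ v + suc f + suc a + 2 * c
      lemma = solve-∀

-- A leg marks the root corner of its component.
Leg Isolated : State m → Fin m → Set
Leg s d      = α s d ≡ d
Isolated s d = σ s d ≡ d × α s d ≡ d

-- Every component is a rooted planar map.
record Good {m} (s : State m) : Set where
  field
    planar     : Planar s
    leg-exists : ∀ d → ∃ λ l → Leg s l × Connected s d l
    leg-unique : ∀ {l l′} → Leg s l → Leg s l′ → Connected s l l′ → l ≡ l′

open Good

isolated-connected : ∀ {s : State m} → Injective _≡_ _≡_ (σ s) → Injective _≡_ _≡_ (α s) →
                     ∀ {d e} → Isolated s d → Connected s d e → e ≡ d
isolated-connected {s = s} σ-inj α-inj {d} (σd , αd) r = proj₁ (Eq.fold equivalence step r) refl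
  where
  _⇔d_ : Rel _ 0ℓ
  e ⇔d e′ = (e ≡ d → e′ ≡ d) × (e′ ≡ d → e ≡ d)
  equivalence : IsEquivalence _⇔d_
  equivalence = record
    { refl = id , id ; sym = λ (f , g) → g , f ; trans = λ (f , g) (f′ , g′) → f′ ∘ f , g ∘ g′ }
  step : Linked s ⇒ _⇔d_
  step (inj₁ refl) = (λ { refl → σd }) , (λ eq → σ-inj (trans eq (sym σd)))
  step (inj₂ refl) = (λ { refl → αd }) , (λ eq → α-inj (trans eq (sym αd)))

glue : Fin m → Fin m → Fin m → State m → State m
glue p y z s = σ⇄ p y (α⇄ y z s)

Hub : Fin m → Fin m → Fin m → State m → Fin m → Set
Hub p y z s d = ∃ λ h → Connected s d h × (h ≡ p ⊎ h ≡ y ⊎ h ≡ z)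

glue-cases : ∀ {s : State m} {p y z d e} → Connected (glue p y z s) d e →
             Connected s d e ⊎ (Hub p y z s d × Hub p y z s e)
glue-cases {s = s} {p} {y} {z} r with cong-edge (≈-⊆ (≈-sym (σ⇄-linked (α⇄ y z s))) r)
... | inj₁ r with cong-edge (≈-⊆ (≈-sym (α⇄-linked s)) r)
...   | inj₁ r       = inj₁ r
...   | inj₂ (u , v) = inj₂ (near u , near v)
  where
  near : ∀ {d} → Connected s d y ⊎ Connected s d z → Hub p y z s d
  near (inj₁ r) = y , r , inj₂ (inj₁ refl)
  near (inj₂ r) = z , r , inj₂ (inj₂ refl)
glue-cases {s = s} {p} {y} {z} r | inj₂ (u , v) = inj₂ (near u , near v)
  where
  lower : ∀ {d h} → h ≡ p ⊎ h ≡ y ⊎ h ≡ z → Connected (α⇄ y z s) d h → Hub p y z s d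
  lower h r with cong-edge (≈-⊆ (≈-sym (α⇄-linked s)) r)
  ... | inj₁ r            = _ , r , h
  ... | inj₂ (inj₁ r , _) = y , r , inj₂ (inj₁ refl)
  ... | inj₂ (inj₂ r , _) = z , r , inj₂ (inj₂ refl)
  near : ∀ {d} → Connected (α⇄ y z s) d p ⊎ Connected (α⇄ y z s) d y → Hub p y z s d
  near (inj₁ r) = lower (inj₁ refl) r
  near (inj₂ r) = lower (inj₂ (inj₁ refl)) r

walk : State m → Fin m → ℕ → Fin m
walk s y i = φ s ^[ suc i ] y

-- The root edge of the map rooted at p is y z.  Its outer face is followed
-- from y until q, the first dart back at the vertex of p, and ℓ vertices are
-- met on the way.  Exchanging x and q in σ makes the root edge a bridge, whose
-- removal leaves in s′ the maps rooted at y and z, and p as an isolated dart.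
record Step {m} (s : State m) (p : Fin m) (ℓ : ℕ) (y z : Fin m) (s′ : State m) : Set where
  field
    x q    : Fin m
    j      : ℕ
    p≢y    : p ≢ y
    σp     : σ s p ≡ y
    αy     : α s y ≡ z
    σy     : σ s y ≡ x
    walk-j : walk s y j ≡ q
    return : Orbit (σ s) p q
    before : ∀ i → i < j → ¬ Orbit (σ s) p (walk s y i)
    count  : Count (σ s) (Prefix (walk s y) j) ℓ
    glued  : s ≗ₛ σ⇄ x q (glue p y z s′)

step-exists : ∀ {s : State m} {p} → Planar s → σ s p ≢ p →
              ∃ λ ℓ → ∃ λ y → ∃ λ z → ∃ (Step s p ℓ y z)
step-exists {s = s} {p} P σp≢p
  with t , per ← period (φ-injective P) (σ s p)
  with j , ret , min ← least (λ i → orbit? (σ s) p (walk s (σ s p) i)) t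
                         (subst (Orbit (σ s) p) (sym per) next)
  with ℓ , cnt ← count-prefix {f = σ s} {w = walk s (σ s p)} j = _ , _ , _ , σ⇄ p y (α⇄ y z (σ⇄ x q s)) , record
    { x = x ; q = q ; j = j ; p≢y = σp≢p ∘ sym
    ; σp = refl ; αy = refl ; σy = refl ; walk-j = refl ; return = ret ; before = min ; count = cnt
    ; glued = (λ d → sym (trans (cong (transpose x q) (transpose-involutive p y (transpose x q (σ s d)))) (transpose-involutive x q (σ s d))))
            , (λ d → sym (transpose-involutive y z (α s d))) }
  where
  y = σ s p
  z = α s y
  x = σ s y
  q = walk s y j

module Analysis {s s′ : State m} {p y z ℓ} (G : Good s) (αp : Leg s p) (st : Step s p ℓ y z s′) where
  open Step st public

  b : State m
  b = σ⇄ x q s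

  private
    P : Planar s
    P = planar G

    b′ s″ : State m
    b′ = α⇄ y z b
    s″ = σ⇄ p y b′

  s′≗s″ : s′ ≗ₛ s″
  s′≗s″ = (λ d → sym (trans (cong (transpose p y) (trans (cong (transpose x q) (proj₁ glued d))
                   (transpose-involutive x q (σ (glue p y z s′) d)))) (transpose-involutive p y (σ s′ d))))
        , (λ d → sym (trans (cong (transpose y z) (proj₂ glued d)) (transpose-involutive y z (α s′ d))))

  s≗ : s ≗ₛ σ⇄ x q b
  s≗ = (λ d → sym (transpose-involutive x q (σ s d))) , λ _ → refl

  b≗glue : b ≗ₛ glue p y z s′
  b≗glue = (λ d → trans (cong (transpose x q) (proj₁ glued d)) (transpose-involutive x q (σ (glue p y z s′) d)))
         , proj₂ glued

  T : Fin m → Fin m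
  T d = transpose p y (transpose x q d)

  σ′ : ∀ d → σ s′ d ≡ T (σ s d)
  σ′ = proj₁ s′≗s″

  α′ : ∀ d → α s′ d ≡ transpose y z (α s d)
  α′ = proj₂ s′≗s″

  φp : φ s p ≡ y
  φp = trans (cong (σ s) αp) σp

  p~y : Orbit (σ s) p y
  p~y = Eq.return σp

  p~x : Orbit (σ s) p x
  p~x = p~y ◅◅ Eq.return σy

  z≢y : z ≢ y
  z≢y z≡y = p≢y (leg-unique G αp (trans αy z≡y) (orbit-σ s p~y))

  αz : α s z ≡ y
  αz = trans (cong (α s) (sym αy)) (α-involutive P y)

  p≢z : p ≢ z
  p≢z refl = p≢y (trans (sym αp) αz)

  φz : φ s z ≡ x
  φz = trans (cong (σ s) αz) σy

  x≢y : x ≢ y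
  x≢y x≡y = p≢y (σ-injective P (trans σp (sym (trans σy x≡y))))

  q≢y : q ≢ y
  q≢y q≡y = no-return j refl
    where
    eq : φ s ^[ suc j ] y ≡ φ s p
    eq = trans walk-j (trans q≡y (sym φp))
    no-return : ∀ i → i ≡ j → ⊥
    no-return zero    refl = p≢y (sym (φ-injective P eq))
    no-return (suc i) refl = before i ℕ.≤-refl (subst (Orbit (σ s) p) (sym (φ-injective P eq)) ε)

  T-fixed : ∀ {d} → d ≢ x → d ≢ q → d ≢ p → d ≢ y → T d ≡ d
  T-fixed d≢x d≢q d≢p d≢y = trans (cong (transpose p y) (transpose-other d≢x d≢q)) (transpose-other d≢p d≢y)

  Off : Fin m → Set
  Off d = ¬ Orbit (σ s) p d

  off-≢ : ∀ {d e} → Off d → Orbit (σ s) p e → d ≢ e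
  off-≢ off r refl = off r

  off-T : ∀ {d} → Off d → T d ≡ d
  off-T off = T-fixed (off-≢ off p~x) (off-≢ off return) (off-≢ off ε) (off-≢ off p~y)

  off-σ : ∀ {d} → Off d → Off (σ s d)
  off-σ off r = off (r ◅◅ ~sym next)

  σ′-off : ∀ {d} → Off d → σ s′ d ≡ σ s d
  σ′-off {d} off = trans (σ′ d) (off-T (off-σ off))

  σb-off : ∀ {d} → Off d → σ b d ≡ σ s d
  σb-off off = transpose-other (off-≢ (off-σ off) p~x) (off-≢ (off-σ off) return)

  agree : ∀ i → i ≤ j → φ s ^[ i ] y ≡ φ b ^[ i ] y
  agree = iterate-agree j λ i i<j → sym (transpose-other
    (off-≢ (before i i<j) p~x) (off-≢ (before i i<j) return))

  walk-b : ∀ i → i < j → walk b y i ≡ walk s y i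
  walk-b i i<j = sym (agree (suc i) i<j)

  walk-b-j : walk b y j ≡ x
  walk-b-j = trans (cong (φ b) (sym (agree j ℕ.≤-refl))) (⇄-right {f = φ s} walk-j)

  y~x : Orbit (φ b) y x
  y~x = subst (Orbit (φ b) y) walk-b-j (iterate-orbit (φ b) (suc j) y)

  φbz : φ b z ≡ q
  φbz = ⇄-left {f = φ s} φz

  x~q-b : Connected b x q
  x~q-b = ~sym (orbit-φ b y~x) ◅◅ orbit-α b (Eq.return αy) ◅◅ orbit-φ b (Eq.return φbz)

  x~q : Orbit (σ s) x q
  x~q = ~sym p~x ◅◅ return

  bridged : Planar b × Orbit (φ b) x q
  bridged with x ≟ q
  ... | yes refl = Planar-resp ((λ d → sym (transpose-same x (σ s d))) , λ _ → refl) P , ε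
  ... | no x≢q with ¬φ , P′ ← planar-split-vertex P x≢q x~q x~q-b = P′ , ⇄-merges (φ-injective P) ¬φ

  cut : Planar b′ × ¬ Connected b′ y z
  cut = planar-cut-edge (proj₁ bridged) (z≢y ∘ sym) αy
    (y~x ◅◅ proj₂ bridged ◅◅ ~sym (Eq.return φbz))

  s⊆b : Connected s ⇒ Connected b
  s⊆b = ≈-related (σ⇄-linked s) (orbit-σ s x~q) x~q-b

  b⊆s : Connected b ⇒ Connected s
  b⊆s = ≈-related (≈-sym (σ⇄-linked s)) x~q-b (orbit-σ s x~q)

  b′⊆s : Connected b′ ⇒ Connected s
  b′⊆s = b⊆s ∘ drop-edge (orbit-α b (Eq.return αy)) ∘ ≈-⊆ (≈-sym (α⇄-linked b))

  σb-p : σ b p ≡ y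
  σb-p = trans (cong (transpose x q) σp) (transpose-other (x≢y ∘ sym) (q≢y ∘ sym))

  s″⊆b′ : Connected s″ ⇒ Connected b′
  s″⊆b′ = drop-edge (orbit-σ b′ (Eq.return σb-p)) ∘ ≈-⊆ (≈-sym (σ⇄-linked b′))

  s′⊆s″ : Connected s′ ⇒ Connected s″
  s′⊆s″ = Eq.map (Linked-resp s′≗s″)

  s″⊆s′ : Connected s″ ⇒ Connected s′
  s″⊆s′ = Eq.map (Linked-resp (≗ₛ-sym s′≗s″))

  s′⊆b′ : Connected s′ ⇒ Connected b′
  s′⊆b′ = s″⊆b′ ∘ s′⊆s″

  s′⊆s : Connected s′ ⇒ Connected s
  s′⊆s = b′⊆s ∘ s′⊆b′

  y≁z : ¬ Connected s′ y z
  y≁z = proj₂ cut ∘ s′⊆b′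

  isolated-p : Isolated s′ p
  isolated-p = trans (proj₁ s′≗s″ p) (⇄-right {f = σ b} σb-p)
             , trans (α′ p) (trans (cong (transpose y z) αp) (transpose-other p≢y p≢z))

  planar′ : Planar s′
  planar′ = Planar-resp (≗ₛ-sym s′≗s″) (planar-detach (proj₁ cut) p≢y (proj₂ isolated″) σb-p λ r →
    p≢y (sym (isolated-connected {s = s″} (⇄-injective {f = σ b′} (σ-injective (proj₁ cut)))
      (α-injective (proj₁ cut)) isolated″ r)))
    where
    isolated″ : Isolated s″ p
    isolated″ = ⇄-right {f = σ b} σb-p , trans (cong (transpose y z) αp) (transpose-other p≢y p≢z)

  p-alone : ∀ {d} → Connected s′ p d → d ≡ p
  p-alone = isolated-connected (σ-injective planar′) (α-injective planar′) isolated-p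

  link-cases : ∀ {d e} → Connected s d e → Connected s′ d e ⊎ (Hub p y z s′ d × Hub p y z s′ e)
  link-cases = glue-cases ∘ Eq.map (Linked-resp b≗glue) ∘ s⊆b

  leg-y : Leg s′ y
  leg-y = trans (α′ y) (trans (cong (transpose y z) αy) (transpose-right y z))

  leg-z : Leg s′ z
  leg-z = trans (α′ z) (trans (cong (transpose y z) αz) (transpose-left y z))

  leg-hub : ∀ {h} → h ≡ p ⊎ h ≡ y ⊎ h ≡ z → Leg s′ h
  leg-hub (inj₁ refl)        = proj₂ isolated-p
  leg-hub (inj₂ (inj₁ refl)) = leg-y
  leg-hub (inj₂ (inj₂ refl)) = leg-z

  leg-keep : ∀ {l} → Leg s l → Leg s′ l
  leg-keep {l} αl = trans (α′ l) (trans (cong (transpose y z) αl)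
    (transpose-other (λ { refl → z≢y (trans (sym αy) αl) }) (λ { refl → z≢y (trans (sym αl) αz) })))

  leg-origin : ∀ {l} → Leg s′ l → Leg s l ⊎ l ≡ y ⊎ l ≡ z
  leg-origin {l} leg with l ≟ y | l ≟ z
  ... | yes l≡y | _       = inj₂ (inj₁ l≡y)
  ... | no _    | yes l≡z = inj₂ (inj₂ l≡z)
  ... | no l≢y  | no l≢z  = inj₁ (trans (sym (transpose-involutive y z (α s l)))
    (trans (cong (transpose y z) (trans (sym (α′ l)) leg)) (transpose-other l≢y l≢z)))

  z~p : Connected s z p
  z~p = ~sym (orbit-α s (Eq.return αy)) ◅◅ ~sym (orbit-σ s p~y)

  good′ : Good s′
  good′ = record { planar = planar′ ; leg-exists = exists ; leg-unique = unique }
    where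
    exists : ∀ d → ∃ λ l → Leg s′ l × Connected s′ d l
    exists d with l , leg , r ← leg-exists G d with link-cases r
    ... | inj₁ r′ = l , leg-keep leg , r′
    ... | inj₂ ((h , r′ , hub) , _) = h , leg-hub hub , r′
    alone : ∀ {l h} → Leg s l → h ≢ p → Connected s h p → ¬ Connected s′ l h
    alone leg h≢p h~p r with refl ← leg-unique G leg αp (s′⊆s r ◅◅ h~p) = h≢p (p-alone r)
    y~p : Connected s y p
    y~p = ~sym (orbit-σ s p~y)
    unique : ∀ {l l′} → Leg s′ l → Leg s′ l′ → Connected s′ l l′ → l ≡ l′
    unique u v r with leg-origin u | leg-origin v
    ... | inj₁ u | inj₁ v = leg-unique G u v (s′⊆s r)
    ... | inj₁ u | inj₂ (inj₁ refl) = contradiction r (alone u (p≢y ∘ sym) y~p)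
    ... | inj₁ u | inj₂ (inj₂ refl) = contradiction r (alone u (p≢z ∘ sym) z~p)
    ... | inj₂ (inj₁ refl) | inj₁ v = contradiction (~sym r) (alone v (p≢y ∘ sym) y~p)
    ... | inj₂ (inj₂ refl) | inj₁ v = contradiction (~sym r) (alone v (p≢z ∘ sym) z~p)
    ... | inj₂ (inj₁ refl) | inj₂ (inj₁ refl) = refl
    ... | inj₂ (inj₁ refl) | inj₂ (inj₂ refl) = contradiction r y≁z
    ... | inj₂ (inj₂ refl) | inj₂ (inj₁ refl) = contradiction (~sym r) y≁z
    ... | inj₂ (inj₂ refl) | inj₂ (inj₂ refl) = refl

  Apart : Fin m → Set
  Apart d = ¬ Connected s p d

  apart-off : ∀ {d} → Apart d → Off d
  apart-off a = a ∘ orbit-σ s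

  apart-σ : ∀ {d} → Apart d → Apart (σ s d)
  apart-σ a r = a (r ◅◅ ~sym (orbit-σ s next))

  apart-α : ∀ {d} → Apart d → Apart (α s d)
  apart-α a r = a (r ◅◅ ~sym (orbit-α s next))

  α′-apart : ∀ {d} → Apart d → α s′ d ≡ α s d
  α′-apart {d} a = trans (α′ d) (transpose-other
    (λ eq → apart-α a (orbit-σ s p~y ◅◅ subst (Connected s y) (sym eq) ε))
    (λ eq → apart-α a (~sym z~p ◅◅ subst (Connected s z) (sym eq) ε)))

  φ′-apart : ∀ {d} → Apart d → φ s′ d ≡ φ s d
  φ′-apart a = trans (cong (σ s′) (α′-apart a)) (σ′-off (apart-off (apart-α a)))

  isolated-keep : ∀ {d} → Isolated s d → Isolated s′ d
  isolated-keep {d} iso@(σd , αd) = trans (σ′-off (apart-off a)) σd , leg-keep αd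
    where
    a : Apart d
    a r with refl ← isolated-connected (σ-injective P) (α-injective P) iso (~sym r) = p≢y (trans (sym σd) σp)

  φ′-T : ∀ {d} → d ≢ y → d ≢ z → φ s′ d ≡ T (φ s d)
  φ′-T {d} d≢y d≢z = trans (σ′ (α s′ d)) (cong (T ∘ σ s) (trans (α′ d) (transpose-other
    (λ eq → d≢z (trans (sym (α-involutive P d)) (trans (cong (α s) eq) αy)))
    (λ eq → d≢y (trans (sym (α-involutive P d)) (trans (cong (α s) eq) αz))))))

  φ′-z : φ s′ z ≡ T (φ s y)
  φ′-z = trans (cong (σ s′) leg-z) (trans (σ′ z) (cong (T ∘ σ s) (sym αy)))

  φ′-y : φ s′ y ≡ transpose p y q
  φ′-y = trans (cong (σ s′) leg-y) (trans (σ′ y) (cong (transpose p y)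
    (trans (cong (transpose x q) σy) (transpose-left x q))))

  p≢x : x ≢ q → p ≢ x
  p≢x x≢q p≡x with orbit-closed {C = λ d → d ≡ p ⊎ d ≡ y} (σ-injective P)
      (λ { (inj₁ refl) → inj₂ σp ; (inj₂ refl) → inj₁ (trans σy (sym p≡x)) }) (inj₁ refl) return
  ... | inj₁ q≡p = x≢q (trans (sym p≡x) (sym q≡p))
  ... | inj₂ q≡y = q≢y q≡y

  walk-≢z : ∀ {i} → suc i < j ⊎ (suc i ≡ j × x ≢ q) → walk s y i ≢ z
  walk-≢z {i} (inj₁ i<j) eq = before (suc i) i<j (subst (Orbit (σ s) p) (sym (trans (cong (φ s) eq) φz)) p~x)
  walk-≢z {i} (inj₂ (refl , x≢q)) eq = x≢q (trans (sym (trans (cong (φ s) eq) φz)) walk-j)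

  walk-≢y : ∀ {i} → i < j → walk s y i ≢ y
  walk-≢y i<j = off-≢ (before _ i<j) p~y

  walk′-T : ∀ i → i < j ⊎ (i ≡ j × x ≢ q) → walk s′ z i ≡ T (walk s y i)
  walk′-T zero    _ = φ′-z
  walk′-T (suc i) h = trans (cong (φ s′) (trans (walk′-T i (inj₁ i<j)) (off-T (before i i<j))))
                            (φ′-T (walk-≢y i<j) (walk-≢z h))
    where
    i<j : i < j
    i<j = [ ℕ.<-trans ℕ.≤-refl , (λ { (refl , _) → ℕ.≤-refl }) ]′ h

  walk′ : ∀ i → i < j → walk s′ z i ≡ walk s y i
  walk′ i i<j = trans (walk′-T i (inj₁ i<j)) (off-T (before i i<j))

  z~walk : ∀ i → i < j → Orbit (φ s′) z (walk s y i)
  z~walk i i<j = subst (Orbit (φ s′) z) (walk′ i i<j) (iterate-orbit (φ s′) (suc i) z)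

  z~x : x ≢ q → Connected s′ z x
  z~x x≢q = orbit-φ s′ (subst (Orbit (φ s′) z)
    (trans (walk′-T j (inj₂ (refl , x≢q))) (trans (cong T walk-j)
      (trans (cong (transpose p y) (transpose-right x q)) (transpose-other (p≢x x≢q ∘ sym) x≢y))))
    (iterate-orbit (φ s′) (suc j) z))

  off-orbit : ∀ {d e} → Off d → Orbit (σ s) d e → Orbit (σ s′) d e
  off-orbit = orbit-local Off (σ-injective P) off-σ (λ off → sym (σ′-off off))

  off-orbit-b : ∀ {d e} → Off d → Orbit (σ s) d e → Orbit (σ b) d e
  off-orbit-b = orbit-local Off (σ-injective P) off-σ (λ off → sym (σb-off off))

  σb⊆σ : Orbit (σ b) ⇒ Orbit (σ s)
  σb⊆σ = drop-edge x~q ∘ ≈-⊆ (≈-sym (⇄-≈ (σ s)))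

  σ′⊆σ : Orbit (σ s′) ⇒ Orbit (σ s)
  σ′⊆σ = σb⊆σ ∘ drop-edge (Eq.return σb-p) ∘ ≈-⊆ (≈-sym (⇄-≈ (σ b))) ∘ Orbit-resp (proj₁ s′≗s″)

  near-orbit : ∀ {d e} → Connected s′ y d → Connected s′ y e → Orbit (σ s) d e → Orbit (σ s′) d e
  near-orbit {d} {e} yd ye r = lower (split r)
    where
    not-x : ∀ {d} → x ≢ q → Connected s′ y d → ¬ Orbit (σ b) d x
    not-x x≢q yd r = proj₂ cut (s′⊆b′ yd ◅◅ orbit-σ b′ r ◅◅ ~sym (s′⊆b′ (z~x x≢q)))
    split : Orbit (σ s) d e → Orbit (σ b) d e
    split r with x ≟ q
    ... | yes refl = Orbit-resp (λ c → sym (transpose-same x (σ s c))) r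
    ... | no x≢q with cong-edge (≈-⊆ (⇄-≈ (σ s)) r)
    ...   | inj₁ r = r
    ...   | inj₂ (inj₁ u , _) = contradiction u (not-x x≢q yd)
    ...   | inj₂ (inj₂ u , inj₁ v) = contradiction v (not-x x≢q ye)
    ...   | inj₂ (inj₂ u , inj₂ v) = u ◅◅ ~sym v
    lower : Orbit (σ b) d e → Orbit (σ s′) d e
    lower r with cong-edge (≈-⊆ (⇄-≈ (σ b)) r)
    ... | inj₁ r = Orbit-resp (λ c → sym (proj₁ s′≗s″ c)) r
    ... | inj₂ (u , v) = near yd u ◅◅ ~sym (near ye v)
      where
      near : ∀ {d} → Connected s′ y d → Orbit (σ s″) d p ⊎ Orbit (σ s″) d y → Orbit (σ s′) d y
      near yd (inj₁ r) = contradiction (sym (p-alone (~sym (yd ◅◅ s″⊆s′ (orbit-σ s″ r))))) p≢y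
      near yd (inj₂ r) = Orbit-resp (λ c → sym (proj₁ s′≗s″ c)) r

  Visited : Fin m → Set
  Visited = Prefix (walk s y) j

  outer : ∀ {d} → Orbit (φ s) p d → Visited d ⊎ d ≡ p ⊎ Orbit (φ s′) y d
  outer = orbit-closed {C = Outer} (φ-injective P) closed (inj₂ (inj₁ refl))
    where
    Outer : Fin m → Set
    Outer d = Visited d ⊎ d ≡ p ⊎ Orbit (φ s′) y d
    outer-q : Outer q
    outer-q with q ≟ p
    ... | yes q≡p = inj₂ (inj₁ q≡p)
    ... | no q≢p  = inj₂ (inj₂ (Eq.return (trans φ′-y (transpose-other q≢p q≢y))))
    outer-walk : ∀ i → i ≤ j → Outer (walk s y i)
    outer-walk i i≤j with ℕ.m≤n⇒m<n∨m≡n i≤j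
    ... | inj₁ i<j  = inj₁ (i , i<j , refl)
    ... | inj₂ refl = subst Outer (sym walk-j) outer-q
    closed : ∀ {d} → Outer d → Outer (φ s d)
    closed (inj₁ (i , i<j , refl)) = outer-walk (suc i) i<j
    closed (inj₂ (inj₁ refl))      = subst Outer (sym φp) (inj₂ (inj₂ ε))
    closed {d} (inj₂ (inj₂ r)) with d ≟ y
    ... | yes refl = outer-walk 0 z≤n
    ... | no d≢y with φ s d ≟ x | φ s d ≟ q | φ s d ≟ p | φ s d ≟ y
    ...   | yes eq | _ | _ | _ =
            contradiction (subst (Connected s′ y) (φ-injective P (trans eq (sym φz))) (orbit-φ s′ r)) y≁z
    ...   | _ | yes eq | _ | _ = subst Outer (sym eq) outer-q
    ...   | _ | _ | yes eq | _ = inj₂ (inj₁ eq)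
    ...   | _ | _ | _ | yes eq = subst Outer (sym eq) (inj₂ (inj₂ ε))
    ...   | no ≢x | no ≢q | no ≢p | no ≢y = inj₂ (inj₂ (r ◅◅ Eq.return
            (trans (φ′-T d≢y λ { refl → y≁z (orbit-φ s′ r) }) (T-fixed ≢x ≢q ≢p ≢y))))

  inner : ∀ {d} → Orbit (φ s′) y d → Orbit (φ s) p d
  inner {d} r = proj₁ (orbit-closed {C = Inner} (φ-injective planar′) closed (Eq.return φp , ε) r)
    where
    Inner : Fin m → Set
    Inner d = Orbit (φ s) p d × Orbit (φ s′) y d
    closed : ∀ {d} → Inner d → Inner (φ s′ d)
    closed {d} (u , v) = on-face , v ◅◅ next
      where
      d≢z : d ≢ z
      d≢z refl = y≁z (orbit-φ s′ v)
      p~q : Orbit (φ s) p q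
      p~q = Eq.return φp ◅◅ subst (Orbit (φ s) y) walk-j (iterate-orbit (φ s) (suc j) y)
      on-face : Orbit (φ s) p (φ s′ d)
      on-face with d ≟ y
      ... | yes refl with q ≟ p
      ...   | yes refl = subst (Orbit (φ s) p) (sym (trans φ′-y (transpose-left p y))) (Eq.return φp)
      ...   | no q≢p   = subst (Orbit (φ s) p) (sym (trans φ′-y (transpose-other q≢p q≢y))) p~q
      on-face | no d≢y with φ s d ≟ x | φ s d ≟ q | φ s d ≟ p | φ s d ≟ y
      ... | yes eq | _ | _ | _ = contradiction (φ-injective P (trans eq (sym φz))) d≢z
      ... | _ | yes eq | _ | _ = ⊥-elim (before-q j refl)
        where
        before-q : ∀ i → i ≡ j → ⊥
        before-q zero    refl = d≢y (φ-injective P (trans eq (sym walk-j)))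
        before-q (suc i) refl with refl ← φ-injective P (trans eq (sym walk-j)) =
          y≁z (orbit-φ s′ v ◅◅ ~sym (orbit-φ s′ (z~walk i ℕ.≤-refl)))
      ... | _ | _ | _ | yes eq with refl ← φ-injective P (trans eq (sym φp)) =
        contradiction (sym (p-alone (~sym (orbit-φ s′ v)))) p≢y
      ... | no ≢x | no ≢q | yes eq | _ = subst (Orbit (φ s) p)
        (sym (trans (φ′-T d≢y d≢z) (trans (cong (transpose p y) (transpose-other ≢x ≢q)) (⇄-left {f = φ s} eq))))
        (Eq.return φp)
      ... | no ≢x | no ≢q | no ≢p | no ≢y = subst (Orbit (φ s) p)
        (sym (trans (φ′-T d≢y d≢z) (T-fixed ≢x ≢q ≢p ≢y))) (u ◅◅ next)

  visited-outer : ∀ {d} → Visited d → Orbit (φ s) p d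
  visited-outer (i , _ , refl) = Eq.return φp ◅◅ iterate-orbit (φ s) (suc i) y

  visited-z : ∀ {d} → Visited d → Orbit (φ s′) z d
  visited-z (i , i<j , refl) = z~walk i i<j

  visited-off : ∀ {d} → Visited d → Off d
  visited-off (i , i<j , refl) = before i i<j

  outv-step : ∀ {k} → Count (σ s′) (Orbit (φ s′) y) k → Count (σ s) (Orbit (φ s) p) (ℓ + k)
  outv-step c = Count-map id
    [ visited-outer , inner ]′ (λ _ _ → id) (λ _ _ → id)
    (λ r → case outer r of λ
      { (inj₁ v)           → _ , inj₁ v , ε
      ; (inj₂ (inj₁ refl)) → y , inj₂ ε , p~y
      ; (inj₂ (inj₂ r′))   → _ , inj₂ r′ , ε })
    (Count-⊎
      (λ v r t → y≁z (orbit-φ s′ r ◅◅ ~sym (orbit-σ s′ (off-orbit (visited-off v) t)) ◅◅ ~sym (orbit-φ s′ (visited-z v))))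
      count
      (Count-map id id (λ _ _ → σ′⊆σ) (λ u v → near-orbit (orbit-φ s′ u) (orbit-φ s′ v)) (λ r → _ , r , ε) c))

  outv-bound : ∀ {k} → Count (σ s′) (Orbit (φ s′) z) k → ℓ ≤ k
  outv-bound = Count-≤ id visited-z (λ _ _ → σ′⊆σ) count

  outv-apart : ∀ {r k} → Apart r → Count (σ s′) (Orbit (φ s′) r) k → Count (σ s) (Orbit (φ s) r) k
  outv-apart {r} a = Count-map id
    (orbit-local Apart (φ-injective planar′) closed φ′-apart a)
    (λ _ _ → σ′⊆σ)
    (λ u _ → off-orbit (apart-off (orbit-closed {C = Apart} (φ-injective planar′) closed a u)))
    (λ u → _ , orbit-local Apart (φ-injective P) (apart-σ ∘ apart-α) (λ c → sym (φ′-apart c)) a u , ε)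
    where
    closed : ∀ {d} → Apart d → Apart (φ s′ d)
    closed c = subst Apart (sym (φ′-apart c)) (apart-σ (apart-α c))

  leg-apart : ∀ {r} → Leg s′ r → r ≢ p → r ≢ y → r ≢ z → Apart r
  leg-apart leg r≢p r≢y r≢z c with link-cases c
  ... | inj₁ c′ = r≢p (p-alone c′)
  ... | inj₂ (_ , h , c′ , hub) with refl ← leg-unique good′ leg (leg-hub hub) c′ = case hub of λ
    { (inj₁ eq) → r≢p eq ; (inj₂ (inj₁ eq)) → r≢y eq ; (inj₂ (inj₂ eq)) → r≢z eq }

  isolated-origin : ∀ {r} → Isolated s′ r → r ≢ p → r ≢ y → r ≢ z → Isolated s r
  isolated-origin (σ′r , α′r) r≢p r≢y r≢z =
    trans (sym (σ′-off (apart-off apart))) σ′r , trans (sym (α′-apart apart)) α′r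
    where
    apart = leg-apart α′r r≢p r≢y r≢z

  new-b : New (σ b) (walk b y) j
  new-b i i<j r = before i i<j (p~x ◅◅ ~sym (subst₂ (Orbit (σ s)) (walk-b i i<j) walk-b-j (σb⊆σ r)))

  count-b : Count (σ b) (Prefix (walk b y) j) ℓ
  count-b = Count-map id
    (λ { (i , i<j , eq) → i , i<j , trans eq (sym (walk-b i i<j)) })
    (λ u _ → off-orbit-b (visited-off u)) (λ _ _ → σb⊆σ)
    (λ { (i , i<j , eq) → _ , (i , i<j , trans eq (walk-b i i<j)) , ε }) count

record Iso {m} (π : Fin m → Fin m) (s t : State m) : Set where
  field
    injective : Injective _≡_ _≡_ π
    π-σ       : ∀ d → π (σ s d) ≡ σ t (π d)
    π-α       : ∀ d → π (α s d) ≡ α t (π d)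

  π-φ : ∀ d → π (φ s d) ≡ φ t (π d)
  π-φ d = trans (π-σ (α s d)) (cong (σ t) (π-α d))

open Iso

Iso-resp : ∀ {π} {s t s₁ t₁ : State m} → s ≗ₛ s₁ → t ≗ₛ t₁ → Iso π s t → Iso π s₁ t₁
Iso-resp {π = π} (p , q) (p₁ , q₁) I = record
  { injective = injective I
  ; π-σ       = λ d → trans (cong π (sym (p d))) (trans (π-σ I d) (p₁ (π d)))
  ; π-α       = λ d → trans (cong π (sym (q d))) (trans (π-α I d) (q₁ (π d)))
  }

module _ {π : Fin m → Fin m} where
  Iso-σ⇄ : ∀ {s t a b a′ b′} → π a ≡ a′ → π b ≡ b′ → Iso π s t → Iso π (σ⇄ a b s) (σ⇄ a′ b′ t)
  Iso-σ⇄ {s} {t} {a} {b} refl refl I = record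
    { injective = injective I
    ; π-σ       = λ d → trans (transpose-natural (injective I) a b (σ s d)) (cong (transpose (π a) (π b)) (π-σ I d))
    ; π-α       = π-α I
    }

  Iso-α⇄ : ∀ {s t a b a′ b′} → π a ≡ a′ → π b ≡ b′ → Iso π s t → Iso π (α⇄ a b s) (α⇄ a′ b′ t)
  Iso-α⇄ {s} {t} {a} {b} refl refl I = record
    { injective = injective I
    ; π-σ       = π-σ I
    ; π-α       = λ d → trans (transpose-natural (injective I) a b (α s d)) (cong (transpose (π a) (π b)) (π-α I d))
    }

  module _ {f g : Fin m → Fin m} (π-f : ∀ d → π (f d) ≡ g (π d)) where
    iterate-natural : ∀ k d → π (f ^[ k ] d) ≡ g ^[ k ] (π d)
    iterate-natural zero    d = refl
    iterate-natural (suc k) d = trans (π-f _) (cong g (iterate-natural k d))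

    orbit-preserve : ∀ {d e} → Orbit f d e → Orbit g (π d) (π e)
    orbit-preserve = Eq.gmap π λ { refl → sym (π-f _) }

    orbit-reflect : Injective _≡_ _≡_ π → Injective _≡_ _≡_ g → ∀ {d e} → Orbit g (π d) (π e) → Orbit f d e
    orbit-reflect π-inj g-inj {d} r with k , eq ← orbit⇒iterate g-inj r =
      subst (Orbit f d) (π-inj (trans (iterate-natural k d) eq)) (iterate-orbit f k d)

  module _ {s t : State m} (I : Iso π s t) (inj : Injective _≡_ _≡_ (σ t)) {y : Fin m} where
    walk-natural : ∀ i → π (walk s y i) ≡ walk t (π y) i
    walk-natural i = iterate-natural {f = φ s} {g = φ t} (π-φ I) (suc i) y

    count-natural : ∀ {j k} → Count (σ s) (Prefix (walk s y) j) k → Count (σ t) (Prefix (walk t (π y)) j) k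
    count-natural = Count-map π
      (λ { (i , i<j , refl) → i , i<j , walk-natural i })
      (λ _ _ → orbit-preserve (π-σ I)) (λ _ _ → orbit-reflect (π-σ I) (injective I) inj)
      (λ { (i , i<j , refl) → _ , (i , i<j , refl) , subst (Orbit (σ t) _) (sym (walk-natural i)) ε })

    new-natural : ∀ {j} → New (σ s) (walk s y) j → New (σ t) (walk t (π y)) j
    new-natural {j} new i i<j r = new i i<j (orbit-reflect (π-σ I) (injective I) inj
      (subst₂ (Orbit (σ t)) (sym (walk-natural i)) (sym (walk-natural j)) r))

module _ {π : Fin m → Fin m} {s s′ t t′ : State m} {p y z p₁ y₁ z₁ : Fin m} {ℓ ℓ₁ : ℕ}
         (Gs : Good s) (Gt : Good t) (αp : Leg s p) (αp₁ : Leg t p₁)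
         (S : Step s p ℓ y z s′) (S₁ : Step t p₁ ℓ₁ y₁ z₁ t′) (πp : π p ≡ p₁) where
  private
    module S  = Analysis Gs αp S
    module S₁ = Analysis Gt αp₁ S₁

  step-forward : Iso π s t → ℓ ≡ ℓ₁ × π y ≡ y₁ × π z ≡ z₁ × Iso π s′ t′
  step-forward I = ℓ≡ , πy , πz ,
    Iso-resp (≗ₛ-sym S.s′≗s″) (≗ₛ-sym S₁.s′≗s″) (Iso-σ⇄ πp πy (Iso-α⇄ πy πz (Iso-σ⇄ πx πq I)))
    where
    inj : Injective _≡_ _≡_ (σ t)
    inj = σ-injective (planar Gt)
    πy : π y ≡ y₁
    πy = trans (cong π (sym S.σp)) (trans (π-σ I p) (trans (cong (σ t) πp) S₁.σp))
    πz : π z ≡ z₁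
    πz = trans (cong π (sym S.αy)) (trans (π-α I y) (trans (cong (α t) πy) S₁.αy))
    πx : π S.x ≡ S₁.x
    πx = trans (cong π (sym S.σy)) (trans (π-σ I y) (trans (cong (σ t) πy) S₁.σy))
    walks : ∀ i → π (walk s y i) ≡ walk t y₁ i
    walks i = trans (walk-natural I inj i) (cong (λ y → walk t y i) πy)
    j≡ : S.j ≡ S₁.j
    j≡ = ℕ.≤-antisym
      (ℕ.≮⇒≥ λ lt → S.before S₁.j lt (orbit-reflect (π-σ I) (injective I) inj
        (subst₂ (Orbit (σ t)) (sym πp) (trans (sym S₁.walk-j) (sym (walks S₁.j))) S₁.return)))
      (ℕ.≮⇒≥ λ lt → S₁.before S.j lt (subst₂ (Orbit (σ t)) πp (trans (cong π (sym S.walk-j)) (walks S.j))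
        (orbit-preserve (π-σ I) S.return)))
    πq : π S.q ≡ S₁.q
    πq = trans (cong π (sym S.walk-j)) (trans (walks S.j) (trans (cong (walk t y₁) j≡) S₁.walk-j))
    ℓ≡ : ℓ ≡ ℓ₁
    ℓ≡ = Count-unique (subst₂ (λ y j → Count (σ t) (Prefix (walk t y) j) ℓ) πy j≡ (count-natural I inj S.count)) S₁.count

  step-backward : ℓ ≡ ℓ₁ → π y ≡ y₁ → π z ≡ z₁ → Iso π s′ t′ → Iso π s t
  step-backward refl πy πz I = Iso-resp (≗ₛ-sym S.s≗) (≗ₛ-sym S₁.s≗) (Iso-σ⇄ πx πq Iᵇ)
    where
    Iᵇ : Iso π S.b S₁.b
    Iᵇ = Iso-resp (≗ₛ-sym S.b≗glue) (≗ₛ-sym S₁.b≗glue) (Iso-σ⇄ πp πy (Iso-α⇄ πy πz I))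
    inj : Injective _≡_ _≡_ (σ S₁.b)
    inj = ⇄-injective {f = σ t} (σ-injective (planar Gt))
    j≡ : S.j ≡ S₁.j
    j≡ = first-visit-unique
      (subst (λ y → New (σ S₁.b) (walk S₁.b y) S.j) πy (new-natural Iᵇ inj S.new-b))
      (subst (λ y → Count (σ S₁.b) (Prefix (walk S₁.b y) S.j) ℓ) πy (count-natural Iᵇ inj S.count-b))
      S₁.new-b S₁.count-b
    πx : π S.x ≡ S₁.x
    πx = trans (cong π (sym S.walk-b-j)) (trans (walk-natural Iᵇ inj S.j)
           (trans (cong₂ (walk S₁.b) πy j≡) S₁.walk-b-j))
    πq : π S.q ≡ S₁.q
    πq = trans (cong π (sym S.φbz)) (trans (π-φ Iᵇ z) (trans (cong (φ S₁.b) πz) S₁.φbz))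

module Build {t : State m} (G : Good t) {p y z : Fin m} (iso-p : Isolated t p) (leg-y : Leg t y) (leg-z : Leg t z)
             (p≢y : p ≢ y) (p≢z : p ≢ z) (y≢z : y ≢ z) where
  private
    P : Planar t
    P = planar G

    t₁ b : State m
    t₁ = α⇄ y z t
    b  = glue p y z t

    y≁z : ¬ Connected t y z
    y≁z = y≢z ∘ leg-unique G leg-y leg-z

    p-alone : ∀ {d} → Connected t p d → d ≡ p
    p-alone = isolated-connected (σ-injective P) (α-injective P) iso-p

    P₁ : Planar t₁
    P₁ = planar-add-edge P leg-y leg-z y≁z

    α₁p : α t₁ p ≡ p
    α₁p = trans (cong (transpose y z) (proj₂ iso-p)) (transpose-other p≢y p≢z)

    Pb : Planar b
    Pb = planar-join P₁ λ r → p≢y (sym (isolated-connected (σ-injective P₁) (α-injective P₁) (proj₁ iso-p , α₁p) r))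

    Z : Fin m → Set
    Z = Connected t z

    Z-≢p : ∀ {d} → Z d → d ≢ p
    Z-≢p c refl = p≢z (sym (p-alone (~sym c)))

    Z-≢y : ∀ {d} → Z d → d ≢ y
    Z-≢y c refl = y≁z (~sym c)

    Z-σ : ∀ {d} → Z d → Z (σ t d)
    Z-σ c = c ◅◅ orbit-σ t next

    Z-α : ∀ {d} → Z d → Z (α t d)
    Z-α c = c ◅◅ orbit-α t next

    σb-Z : ∀ {d} → Z d → σ b d ≡ σ t d
    σb-Z c = transpose-other (Z-≢p (Z-σ c)) (Z-≢y (Z-σ c))

    φb-Z : ∀ {d} → Z d → d ≢ z → φ b d ≡ φ t d
    φb-Z {d} c d≢z = trans (cong (σ b) (transpose-other (Z-≢y (Z-α c))
      λ eq → d≢z (α-injective P (trans eq (sym leg-z))))) (σb-Z (Z-α c))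

    αby : α b y ≡ z
    αby = ⇄-left {f = α t} leg-y

    αbz : α b z ≡ y
    αbz = ⇄-right {f = α t} leg-z

    σbp : σ b p ≡ y
    σbp = ⇄-left {f = σ t} (proj₁ iso-p)

    q : Fin m
    q = σ b y

    q-cases : q ≢ y × (q ≡ p ⊎ Connected t y q)
    q-cases with σ t y ≟ y
    ... | yes eq = (λ q≡y → p≢y (trans (sym q≡p) q≡y)) , inj₁ q≡p
      where
      q≡p : q ≡ p
      q≡p = ⇄-right {f = σ t} eq
    ... | no σy≢y = (σy≢y ∘ trans (sym q≡)) , inj₂ (subst (Connected t y) (sym q≡) (orbit-σ t next))
      where
      q≡ : q ≡ σ t y
      q≡ = transpose-other (λ eq → p≢y (σ-injective P (trans (proj₁ iso-p) (sym eq)))) σy≢y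

    ¬Z-q : ¬ Z q
    ¬Z-q c with proj₂ q-cases
    ... | inj₁ q≡p = Z-≢p c q≡p
    ... | inj₂ r   = y≁z (r ◅◅ ~sym c)

    φbz : φ b z ≡ q
    φbz = cong (σ b) αbz

    opaque
      turn : ∃ λ τ → φ t ^[ suc τ ] z ≡ z × ∀ i → i < τ → φ t ^[ suc i ] z ≢ z
      turn with τ , per ← period (φ-injective P) z = least (λ i → φ t ^[ suc i ] z ≟ z) τ per

    τ : ℕ
    τ = proj₁ turn

    Z-walk : ∀ i → Z (walk t z i)
    Z-walk i = orbit-φ t (iterate-orbit (φ t) (suc i) z)

    walk-b : ∀ i → i ≤ τ → walk b y i ≡ walk t z i
    walk-b zero    _   = trans (cong (σ b) αby) (trans (σb-Z ε) (sym (cong (σ t) leg-z)))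
    walk-b (suc i) i<τ = trans (cong (φ b) (walk-b i (ℕ.<⇒≤ i<τ))) (φb-Z (Z-walk i) (proj₂ (proj₂ turn) i i<τ))

    walk-τ : walk b y τ ≡ z
    walk-τ = trans (walk-b τ ℕ.≤-refl) (proj₁ (proj₂ turn))

    walk-suc-τ : walk b y (suc τ) ≡ q
    walk-suc-τ = trans (cong (φ b) walk-τ) φbz

    Z-walk-b : ∀ {i} → i ≤ τ → Z (walk b y i)
    Z-walk-b {i} i≤τ = subst Z (sym (walk-b i i≤τ)) (Z-walk i)

    local : ∀ {d e} → Z d → Orbit (σ b) d e → Orbit (σ t) d e
    local = orbit-local Z (σ-injective Pb) (λ c → subst Z (sym (σb-Z c)) (Z-σ c)) σb-Z

    local′ : ∀ {d e} → Z d → Orbit (σ t) d e → Orbit (σ b) d e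
    local′ = orbit-local Z (σ-injective P) Z-σ (sym ∘ σb-Z)

    face-prefix : ∀ {d} → Orbit (φ t) z d → Prefix (walk b y) (suc τ) d
    face-prefix r = orbit-closed (φ-injective P) closed (τ , ℕ.≤-refl , sym walk-τ) r
      where
      closed : ∀ {d} → Prefix (walk b y) (suc τ) d → Prefix (walk b y) (suc τ) (φ t d)
      closed (i , s≤s i≤τ , refl) with ℕ.m≤n⇒m<n∨m≡n i≤τ
      ... | inj₁ i<τ  = suc i , s≤s i<τ , trans (cong (φ t) (walk-b i i≤τ)) (sym (walk-b (suc i) i<τ))
      ... | inj₂ refl = 0 , s≤s z≤n , trans (cong (φ t) walk-τ) (sym (walk-b 0 z≤n))

    enough : ∀ {k c} → Count (σ t) (Orbit (φ t) z) k → Count (σ b) (Prefix (walk b y) (suc (suc τ))) c → k < c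
    enough {k} {c} ck cc = subst (_≤ c) (ℕ.+-comm k 1) (Count-≤ id
      (λ { (inj₁ r) → let (i , i<τ , eq) = face-prefix r in i , ℕ.m<n⇒m<1+n i<τ , eq
         ; (inj₂ refl) → suc τ , ℕ.≤-refl , sym walk-suc-τ })
      (λ _ _ → id)
      (Count-⊎ (λ { r refl r′ → ¬Z-q (orbit-φ t r ◅◅ orbit-σ t (local (orbit-φ t r) r′)) })
        (Count-map id id (λ u _ → local′ (orbit-φ t u)) (λ u _ → local (orbit-φ t u)) (λ r → _ , r , ε) ck)
        (Count-≡ q))
      cc)

  module _ {ℓ j : ℕ} (j≤ : j ≤ suc τ) (new : New (σ b) (walk b y) j)
           (cnt : Count (σ b) (Prefix (walk b y) j) ℓ) where
    private
      x : Fin m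
      x = walk b y j

      s : State m
      s = σ⇄ x q b

      x-cases : x ≡ q ⊎ Z x
      x-cases with ℕ.m≤n⇒m<n∨m≡n j≤
      ... | inj₁ (s≤s j≤τ) = inj₂ (Z-walk-b j≤τ)
      ... | inj₂ refl      = inj₁ walk-suc-τ

      earlier : ∀ {i} → i < j → Z (walk b y i)
      earlier i<j = Z-walk-b (s≤s⁻¹ (ℕ.<-≤-trans i<j j≤))

      x≁q : Z x → ¬ Orbit (σ b) x q
      x≁q zx r = ¬Z-q (zx ◅◅ orbit-σ t (local zx r))

      x~q-φ : Orbit (φ b) x q
      x~q-φ = ~sym (iterate-orbit (φ b) (suc j) y) ◅◅
        subst (Orbit (φ b) y) walk-suc-τ (iterate-orbit (φ b) (suc (suc τ)) y)

      planar-s : Planar s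
      planar-s with x-cases
      ... | inj₁ x≡q = Planar-resp
              ((λ d → sym (trans (cong (λ a → transpose a q (σ b d)) x≡q) (transpose-same q (σ b d)))) , λ _ → refl) Pb
      ... | inj₂ zx  = planar-merge-vertex Pb (x≁q zx) x~q-φ

      x~q : Orbit (σ s) x q
      x~q with x-cases
      ... | inj₁ x≡q = subst (Orbit (σ s) x) x≡q ε
      ... | inj₂ zx  = ⇄-merges (σ-injective Pb) (x≁q zx)

      x≢y : x ≢ y
      x≢y with x-cases
      ... | inj₁ x≡q = proj₁ q-cases ∘ trans (sym x≡q)
      ... | inj₂ zx  = Z-≢y zx

      σsp : σ s p ≡ y
      σsp = trans (cong (transpose x q) σbp) (transpose-other (x≢y ∘ sym) (proj₁ q-cases ∘ sym))

      σsy : σ s y ≡ x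
      σsy = transpose-right x q

      agree : ∀ i → i ≤ j → φ b ^[ i ] y ≡ φ s ^[ i ] y
      agree = iterate-agree j λ i i<j → sym (transpose-other
        (λ eq → new i i<j (subst (Orbit (σ b) (walk b y i)) eq ε))
        (λ eq → ¬Z-q (subst Z eq (earlier i<j))))

      walk-s : ∀ {i} → i < j → walk s y i ≡ walk b y i
      walk-s {i} i<j = sym (agree (suc i) i<j)

      σb⊆σs : Orbit (σ b) ⇒ Orbit (σ s)
      σb⊆σs = drop-edge x~q ∘ ≈-⊆ (⇄-≈ (σ b))

      σs⊆σb : ∀ {i e} → i < j → Orbit (σ s) e (walk b y i) → Orbit (σ b) e (walk b y i)
      σs⊆σb {i} i<j r with cong-edge (≈-⊆ (≈-sym (⇄-≈ (σ b))) r)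
      ... | inj₁ r             = r
      ... | inj₂ (_ , inj₁ r) = contradiction r (new i i<j)
      ... | inj₂ (_ , inj₂ r) = contradiction (earlier i<j ◅◅ orbit-σ t (local (earlier i<j) r)) ¬Z-q

      αsp : Leg s p
      αsp = α₁p

      step : Step s p ℓ y z t
      step = record
        { x = x ; q = q ; j = j ; p≢y = p≢y ; σp = σsp ; αy = αby ; σy = σsy
        ; walk-j = trans (cong (φ s) (sym (agree j ℕ.≤-refl))) (transpose-left x q)
        ; return = Eq.return σsp ◅◅ Eq.return σsy ◅◅ x~q
        ; before = λ i i<j r → Z-≢p (earlier i<j ◅◅ orbit-σ t (local (earlier i<j)
            (~sym (σs⊆σb i<j (subst (Orbit (σ s) p) (walk-s i<j) r))))) refl
        ; count  = Count-map id
            (λ { (i , i<j , eq) → i , i<j , trans eq (sym (walk-s i<j)) })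
            (λ _ _ → σb⊆σs)
            (λ { _ (i , i<j , refl) → σs⊆σb i<j })
            (λ { (i , i<j , eq) → _ , (i , i<j , trans eq (walk-s i<j)) , ε }) cnt
        ; glued = (λ _ → refl) , λ _ → refl
        }

      b⊆s : Connected b ⇒ Connected s
      b⊆s = ≈-related (σ⇄-linked b) (orbit-φ b x~q-φ) (orbit-σ s x~q)

      s⊆b : Connected s ⇒ Connected b
      s⊆b = ≈-related (≈-sym (σ⇄-linked b)) (orbit-σ s x~q) (orbit-φ b x~q-φ)

      t⊆s : Connected t ⇒ Connected s
      t⊆s = b⊆s ∘ drop-edge (orbit-σ b (Eq.return σbp)) ∘ ≈-⊆ (σ⇄-linked t₁)
                ∘ drop-edge (orbit-α t₁ (Eq.return αby)) ∘ ≈-⊆ (α⇄-linked t)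

      leg-origin : ∀ {l} → Leg s l → Leg t l × l ≢ y × l ≢ z
      leg-origin {l} leg = trans (sym (transpose-involutive y z (α t l)))
                             (trans (cong (transpose y z) leg) (transpose-other l≢y l≢z)) , l≢y , l≢z
        where
        l≢y : l ≢ y
        l≢y refl = y≢z (trans (sym leg) αby)
        l≢z : l ≢ z
        l≢z refl = y≢z (trans (sym αbz) leg)

      at-p : ∀ {l} → Leg s l → Hub p y z t l → l ≡ p
      at-p leg (h , r , inj₁ refl) = p-alone (~sym r)
      at-p leg (h , r , inj₂ (inj₁ refl)) with leg-origin leg
      ... | l , l≢y , _ = contradiction (leg-unique G l leg-y r) l≢y
      at-p leg (h , r , inj₂ (inj₂ refl)) with leg-origin leg
      ... | l , _ , l≢z = contradiction (leg-unique G l leg-z r) l≢z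

    built : ∃ λ s → Good s × Leg s p × Step s p ℓ y z t
    built = s , record { planar = planar-s ; leg-exists = exists ; leg-unique = unique } , αsp , step
      where
      y~p : Connected s y p
      y~p = ~sym (orbit-σ s (Eq.return σsp))
      exists : ∀ d → ∃ λ l → Leg s l × Connected s d l
      exists d with l , leg , r ← leg-exists G d with l ≟ y | l ≟ z
      ... | yes refl | _        = p , αsp , t⊆s r ◅◅ y~p
      ... | no _     | yes refl = p , αsp , t⊆s r ◅◅ orbit-α s (Eq.return αbz) ◅◅ y~p
      ... | no l≢y   | no l≢z   = l , trans (cong (transpose y z) leg) (transpose-other l≢y l≢z) , t⊆s r
      unique : ∀ {l l′} → Leg s l → Leg s l′ → Connected s l l′ → l ≡ l′
      unique u v r with glue-cases (s⊆b r)
      ... | inj₁ r       = leg-unique G (proj₁ (leg-origin u)) (proj₁ (leg-origin v)) r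
      ... | inj₂ (h , k) = trans (at-p u h) (sym (at-p v k))

  opaque
    build : ∀ {ℓ k} → Count (σ t) (Orbit (φ t) z) k → ℓ ≤ k → ∃ λ s → Good s × Leg s p × Step s p ℓ y z t
    build {ℓ} ck ℓ≤k with first-visit {f = σ b} {w = walk b y} ℓ (suc (suc τ))
    ... | inj₁ (j , s≤s j≤ , new , cnt) = built j≤ new cnt
    ... | inj₂ (c , c≤ℓ , cnt) = contradiction (ℕ.≤-trans (enough ck cnt) (ℕ.≤-trans c≤ℓ ℓ≤k)) ℕ.1+n≰n

record Cut {m} (s : State m) (p : Fin m) (ℓ : ℕ) (y z : Fin m) (s′ : State m) : Set where
  field
    good            : Good s′
    isolated-p      : Isolated s′ p
    leg-y           : Leg s′ y
    leg-z           : Leg s′ z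
    z≢y             : z ≢ y
    leg-keep        : ∀ {l} → Leg s l → Leg s′ l
    leg-≢           : ∀ {l} → Leg s l → l ≢ y × l ≢ z
    leg-origin      : ∀ {l} → Leg s′ l → Leg s l ⊎ l ≡ y ⊎ l ≡ z
    isolated-keep   : ∀ {d} → Isolated s d → Isolated s′ d
    isolated-origin : ∀ {d} → Isolated s′ d → d ≢ p → d ≢ y → d ≢ z → Isolated s d
    edges           : cyc (α s′) ≡ suc (cyc (α s))
    outv-root       : ∀ {k} → Count (σ s′) (Orbit (φ s′) y) k → Count (σ s) (Orbit (φ s) p) (ℓ + k)
    outv-bound      : ∀ {k} → Count (σ s′) (Orbit (φ s′) z) k → ℓ ≤ k
    outv-frame      : ∀ {r k} → Leg s r → r ≢ p →
                      Count (σ s′) (Orbit (φ s′) r) k → Count (σ s) (Orbit (φ s) r) k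

opaque
  cut : ∀ {s s′ : State m} {p ℓ y z} → Good s → Leg s p → Step s p ℓ y z s′ → Cut s p ℓ y z s′
  cut {s = s} {p = p} {y = y} {z} G leg S = record
    { good = good′ ; isolated-p = isolated-p ; leg-y = leg-y ; leg-z = leg-z ; z≢y = z≢y
    ; leg-keep = leg-keep ; leg-≢ = leg-≢ ; leg-origin = leg-origin
    ; isolated-keep = isolated-keep ; isolated-origin = isolated-origin
    ; edges = trans (cyc-cong α′) (cyc-split (α-injective (planar G)) (z≢y ∘ sym) (Eq.return αy))
    ; outv-root = outv-step ; outv-bound = outv-bound
    ; outv-frame = λ l r≢p → let (r≢y , r≢z) = leg-≢ l in outv-apart (leg-apart (leg-keep l) r≢p r≢y r≢z)
    }
    where
    open Analysis G leg S
    leg-≢ : ∀ {l} → Leg s l → l ≢ y × l ≢ z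
    leg-≢ l = (λ { refl → z≢y (trans (sym αy) l) }) , (λ { refl → z≢y (trans (sym l) αz) })

-- Dismantling a map into a forest

darts : List LabelledTree → ℕ
darts []               = 0
darts (node _ us ∷ ts) = suc (darts us) + suc (darts ts)

darts-edges : ∀ ts → darts ts ≡ 2 * #edges′ ts
darts-edges []               = refl
darts-edges (node _ us ∷ ts) = trans (cong₂ (λ a b → suc a + suc b) (darts-edges us) (darts-edges ts))
  (arith (#edges′ us) (#edges′ ts))
  where
  arith : ∀ a b → suc (2 * a) + suc (2 * b) ≡ 2 * (suc a + b)
  arith = solve-∀

total : List LabelledTree → ℤ
total ts = 1ℤ ℤ.+ foldr ℤ._+_ 0ℤ (map label ts)

data Dismantles {m} : List LabelledTree → State m → Fin m → State m → Set where
  []   : ∀ {s p} → Isolated s p → Dismantles [] s p s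
  step : ∀ {s p ℓ y z s₂ ts s₁ us s₀} → Step s p ℓ y z s₂ → Dismantles ts s₂ y s₁ → Dismantles us s₁ z s₀ →
         Dismantles (node (+ ℓ) us ∷ ts) s p s₀

in-us : ∀ us ts → Fin (suc (darts us)) → Fin (suc (suc (darts us) + suc (darts ts)))
in-us us ts i = suc (i ↑ˡ suc (darts ts))

in-ts : ∀ us ts → Fin (suc (darts ts)) → Fin (suc (suc (darts us) + suc (darts ts)))
in-ts us ts i = suc (suc (darts us) ↑ʳ i)

enum : ∀ {ts} {s s₀ : State m} {p} → Dismantles ts s p s₀ → Fin (suc (darts ts)) → Fin m
enum {p = p} _ zero = p
enum {ts = node _ us ∷ _} (step _ u v) (suc i) = [ enum v , enum u ]′ (splitAt (suc (darts us)) i)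

module _ {ts us ℓ} {s s₀ s₁ s₂ : State m} {p y z}
         (S : Step s p ℓ y z s₂) (u : Dismantles ts s₂ y s₁) (v : Dismantles us s₁ z s₀) where
  enum-us : ∀ i → enum (step S u v) (in-us us ts i) ≡ enum v i
  enum-us i = cong [ enum v , enum u ]′ (splitAt-↑ˡ (suc (darts us)) i (suc (darts ts)))

  enum-ts : ∀ i → enum (step S u v) (in-ts us ts i) ≡ enum u i
  enum-ts i = cong [ enum v , enum u ]′ (splitAt-↑ʳ (suc (darts us)) (suc (darts ts)) i)

outer-isolated : ∀ {s : State m} {p} → Planar s → Isolated s p → Count (σ s) (Orbit (φ s) p) 1
outer-isolated {s = s} {p} P iso = Count-map id
  (λ { refl → ε }) (λ _ _ → id) (λ _ _ → id)
  (λ r → p , refl , subst (Orbit (σ s) _) (isolated-connected (σ-injective P) (α-injective P) iso (orbit-φ s r)) ε)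
  (Count-≡ p)

record Dismantled {m} (ts : List LabelledTree) (s : State m) (p : Fin m) (s₀ : State m)
                  (e : Fin (suc (darts ts)) → Fin m) : Set where
  field
    good-end      : Good s₀
    leg-keep      : ∀ {d} → Leg s d → Leg s₀ d
    isolated-keep : ∀ {d} → Isolated s d → Isolated s₀ d
    leg-origin    : ∀ {d} → Leg s₀ d → Leg s d ⊎ ∃ λ i → d ≡ e i
    enum-isolated : ∀ i → Isolated s₀ (e i)
    outv-frame    : ∀ {r k} → Leg s r → r ≢ p → Count (σ s₀) (Orbit (φ s₀) r) k → Count (σ s) (Orbit (φ s) r) k
    edges         : cyc (α s₀) ≡ cyc (α s) + #edges′ ts
    outv-root     : ∃ λ k → + k ≡ total ts × Count (σ s) (Orbit (φ s) p) k
    conditions    : All (AllNodes NonRootCondition) ts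

opaque
  dismantled : ∀ {s s₀ : State m} {p ts} → Good s → Leg s p → (u : Dismantles ts s p s₀) → Dismantled ts s p s₀ (enum u)
  dismantled G leg ([] iso) = record
    { good-end = G ; leg-keep = id ; isolated-keep = id ; leg-origin = inj₁
    ; enum-isolated = λ { zero → iso } ; outv-frame = λ _ _ → id ; edges = sym (ℕ.+-identityʳ _)
    ; outv-root = 1 , refl , outer-isolated (planar G) iso ; conditions = [] }
  dismantled G leg (step S u v) =
    let C = cut G leg S
        U = dismantled (Cut.good C) (Cut.leg-y C) u
        V = dismantled (Dismantled.good-end U) (Dismantled.leg-keep U (Cut.leg-z C)) v
    in dismantled-step C U V
    where
    dismantled-step : ∀ {s s₀ s₁ s₂ : State m} {p y z ℓ us ts} {S : Step s p ℓ y z s₂}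
                        {u : Dismantles ts s₂ y s₁} {v : Dismantles us s₁ z s₀} →
                      Cut s p ℓ y z s₂ → Dismantled ts s₂ y s₁ (enum u) → Dismantled us s₁ z s₀ (enum v) →
                      Dismantled (node (+ ℓ) us ∷ ts) s p s₀ (enum (step S u v))
    dismantled-step {s = s} {s₀} {p = p} {ℓ = ℓ} {us} {ts} {S} {u} {v} C U V = record
      { good-end      = V.good-end
      ; leg-keep      = V.leg-keep ∘ U.leg-keep ∘ C.leg-keep
      ; isolated-keep = V.isolated-keep ∘ U.isolated-keep ∘ C.isolated-keep
      ; leg-origin    = origin
      ; enum-isolated = λ { zero → V.isolated-keep (U.isolated-keep C.isolated-p) ; (suc i) → inside (splitAt (suc (darts us)) i) }
      ; outv-frame    = λ l r≢p → C.outv-frame l r≢p ∘ U.outv-frame (C.leg-keep l) (proj₁ (C.leg-≢ l))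
                                    ∘ V.outv-frame (U.leg-keep (C.leg-keep l)) (proj₂ (C.leg-≢ l))
      ; edges         = trans V.edges (trans (cong (_+ #edges′ us) (trans U.edges (cong (_+ #edges′ ts) C.edges)))
                          (arith (cyc (α s)) (#edges′ ts) (#edges′ us)))
      ; outv-root     = ℓ + proj₁ U.outv-root , label-sum , C.outv-root (proj₂ (proj₂ U.outv-root))
      ; conditions    = node (+≤+ z≤n , bound) V.conditions ∷ U.conditions
      }
      where
      module C = Cut C
      module U = Dismantled U
      module V = Dismantled V
      inside : ∀ t → Isolated s₀ ([ enum v , enum u ]′ t)
      inside (inj₁ i) = V.enum-isolated i
      inside (inj₂ i) = V.isolated-keep (U.enum-isolated i)
      origin : ∀ {d} → Leg s₀ d → Leg s d ⊎ ∃ λ i → d ≡ enum (step S u v) i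
      origin l with V.leg-origin l
      ... | inj₂ (i , eq) = inj₂ (in-us us ts i , trans eq (sym (enum-us S u v i)))
      ... | inj₁ l with U.leg-origin l
      ...   | inj₂ (i , eq) = inj₂ (in-ts us ts i , trans eq (sym (enum-ts S u v i)))
      ...   | inj₁ l with C.leg-origin l
      ...     | inj₁ l = inj₁ l
      ...     | inj₂ (inj₁ refl) = inj₂ (in-ts us ts zero , sym (enum-ts S u v zero))
      ...     | inj₂ (inj₂ refl) = inj₂ (in-us us ts zero , sym (enum-us S u v zero))
      arith : ∀ a b c → suc a + b + c ≡ a + (suc c + b)
      arith = solve-∀
      bound : + ℓ ℤ.≤ total us
      bound with k , eq , c ← V.outv-root = subst (+ ℓ ℤ.≤_) eq
        (+≤+ (C.outv-bound (U.outv-frame C.leg-z C.z≢y c)))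
      label-sum : + (ℓ + proj₁ U.outv-root) ≡ total (node (+ ℓ) us ∷ ts)
      label-sum = trans (cong (λ a → (+ ℓ) ℤ.+ a) (proj₁ (proj₂ U.outv-root))) (swap (+ ℓ) 1ℤ (foldr ℤ._+_ 0ℤ (map label ts)))
        where
        swap : ∀ a b c → a ℤ.+ (b ℤ.+ c) ≡ b ℤ.+ (a ℤ.+ c)
        swap a b c = trans (sym (ℤ.+-assoc a b c)) (trans (cong (ℤ._+ c) (ℤ.+-comm a b)) (ℤ.+-assoc b a c))

opaque
  dismantle : ∀ {s : State m} {p} → Good s → Leg s p → ∃ λ ts → ∃ (Dismantles ts s p)
  dismantle {m = m} {s = s} {p = p} G leg = go (m ∸ cyc (α s)) G leg (ℕ.≤-reflexive (sym (ℕ.m∸n+n≡m (cyc-≤ (α s)))))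
    where
    go : ∀ n {s : State m} {p} → Good s → Leg s p → m ≤ n + cyc (α s) → ∃ λ ts → ∃ (Dismantles ts s p)
    go-cut : ∀ n {s : State m} {p} → Good s → Leg s p → m ≤ n + cyc (α s) →
             (∃ λ ℓ → ∃ λ y → ∃ λ z → ∃ (Step s p ℓ y z)) → ∃ λ ts → ∃ (Dismantles ts s p)
    go n {s} {p} G leg m≤ with σ s p ≟ p
    ... | yes σp   = [] , s , [] (σp , leg)
    ... | no σp≢p = go-cut n G leg m≤ (step-exists (planar G) σp≢p)
    go-cut zero    G leg m≤ (ℓ , y , z , s₂ , S) = contradiction
      (ℕ.≤-trans (ℕ.≤-reflexive (sym (Cut.edges (cut G leg S)))) (ℕ.≤-trans (cyc-≤ (α s₂)) m≤)) ℕ.1+n≰n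
    go-cut (suc n) G leg m≤ (ℓ , y , z , s₂ , S) =
      let C             = cut G leg S
          m≤₂           = ℕ.≤-trans m≤ (ℕ.≤-reflexive (trans (sym (ℕ.+-suc n _)) (cong (λ c → n + c) (sym (Cut.edges C)))))
          (ts , s₁ , u) = go n (Cut.good C) (Cut.leg-y C) m≤₂
          U             = dismantled (Cut.good C) (Cut.leg-y C) u
          (us , s₀ , v) = go n (Dismantled.good-end U) (Dismantled.leg-keep U (Cut.leg-z C))
            (ℕ.≤-trans m≤₂ (ℕ.+-monoʳ-≤ n (ℕ.≤-trans (ℕ.m≤m+n _ _) (ℕ.≤-reflexive (sym (Dismantled.edges U))))))
      in node (+ ℓ) us ∷ ts , s₀ , step S u v

dismantles-forward : ∀ {π : Fin m → Fin m} {s t s₀ t₀ p p₁ ts ts₁} → Good s → Good t → Leg s p → Leg t p₁ →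
                     Iso π s t → π p ≡ p₁ → Dismantles ts s p s₀ → Dismantles ts₁ t p₁ t₀ →
                     ts ≡ ts₁ × Iso π s₀ t₀
dismantles-forward Gs Gt l l₁ I πp ([] _) ([] _) = refl , I
dismantles-forward {π = π} Gs Gt l l₁ I refl ([] (σp , _)) (step S _ _) =
  contradiction (trans (cong π (sym σp)) (trans (π-σ I _) (Step.σp S))) (Step.p≢y S)
dismantles-forward Gs Gt l l₁ I refl (step S _ _) ([] (σp , _)) =
  contradiction (sym (injective I (trans (cong _ (sym (Step.σp S))) (trans (π-σ I _) σp)))) (Step.p≢y S)
dismantles-forward Gs Gt l l₁ I πp (step S u v) (step S₁ u₁ v₁) =
  let C  = cut Gs l S
      C₁ = cut Gt l₁ S₁
      U  = dismantled (Cut.good C) (Cut.leg-y C) u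
      U₁ = dismantled (Cut.good C₁) (Cut.leg-y C₁) u₁
      (ℓ≡ , πy , πz , I₂) = step-forward Gs Gt l l₁ S S₁ πp I
      (ts≡ , I₁) = dismantles-forward (Cut.good C) (Cut.good C₁) (Cut.leg-y C) (Cut.leg-y C₁) I₂ πy u u₁
      (us≡ , I₀) = dismantles-forward (Dismantled.good-end U) (Dismantled.good-end U₁)
        (Dismantled.leg-keep U (Cut.leg-z C)) (Dismantled.leg-keep U₁ (Cut.leg-z C₁)) I₁ πz v v₁
  in cong₂ _∷_ (cong₂ node (cong +_ ℓ≡) us≡) ts≡ , I₀

dismantles-backward : ∀ {π : Fin m → Fin m} {s t s₀ t₀ p p₁ ts} → Good s → Good t → Leg s p → Leg t p₁ →
                      (u : Dismantles ts s p s₀) (u₁ : Dismantles ts t p₁ t₀) →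
                      Iso π s₀ t₀ → (∀ i → π (enum u i) ≡ enum u₁ i) → Iso π s t
dismantles-backward Gs Gt l l₁ ([] _) ([] _) I _ = I
dismantles-backward {π = π} {ts = node _ us ∷ ts} Gs Gt l l₁ (step S u v) (step S₁ u₁ v₁) I eq =
  step-backward Gs Gt l l₁ S S₁ (eq zero) refl (eq-u zero) (eq-v zero)
    (let C  = cut Gs l S
         C₁ = cut Gt l₁ S₁
         U  = dismantled (Cut.good C) (Cut.leg-y C) u
         U₁ = dismantled (Cut.good C₁) (Cut.leg-y C₁) u₁
     in dismantles-backward (Cut.good C) (Cut.good C₁) (Cut.leg-y C) (Cut.leg-y C₁) u u₁
          (dismantles-backward (Dismantled.good-end U) (Dismantled.good-end U₁)
            (Dismantled.leg-keep U (Cut.leg-z C)) (Dismantled.leg-keep U₁ (Cut.leg-z C₁)) v v₁ I eq-v) eq-u)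
  where
  eq-v : ∀ i → π (enum v i) ≡ enum v₁ i
  eq-v i = trans (cong π (sym (enum-us S u v i))) (trans (eq (in-us us ts i)) (enum-us S₁ u₁ v₁ i))
  eq-u : ∀ i → π (enum u i) ≡ enum u₁ i
  eq-u i = trans (cong π (sym (enum-ts S u v i))) (trans (eq (in-ts us ts i)) (enum-ts S₁ u₁ v₁ i))

record Assembled {m} (ts : List LabelledTree) (s₀ : State m) (e : Fin (suc (darts ts)) → Fin m) : Set where
  field
    {whole}         : State m
    good            : Good whole
    dismantles      : Dismantles ts whole (e zero) s₀
    leg             : Leg whole (e zero)
    enum-≗          : enum dismantles ≗ e
    leg-frame       : ∀ {d} → Leg s₀ d → (∀ i → e i ≢ d) → Leg whole d
    leg-origin      : ∀ {d} → Leg whole d → d ≡ e zero ⊎ ∀ i → e i ≢ d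
    isolated-frame  : ∀ {d} → Isolated s₀ d → (∀ i → e i ≢ d) → Isolated whole d

opaque
  assemble : ∀ {s₀ : State m} {ts} → All (AllNodes NonRootCondition) ts → Good s₀ → (e : Fin (suc (darts ts)) → Fin m) →
             Injective _≡_ _≡_ e → (∀ i → Isolated s₀ (e i)) → Assembled ts s₀ e
  assemble [] G e inj iso = record
    { good = G ; dismantles = [] (iso zero) ; leg = proj₂ (iso zero) ; enum-≗ = λ { zero → refl }
    ; leg-frame = λ l _ → l ; isolated-frame = λ i _ → i
    ; leg-origin = λ {d} _ → case e zero ≟ d of λ
        { (yes eq) → inj₁ (sym eq) ; (no ≢d) → inj₂ λ { zero → ≢d } } }
  assemble (node {ℤ.-[1+ _ ]} (() , _) _ ∷ _) _ _ _ _
  assemble {s₀ = s₀} (_∷_ {xs = ts} (node {+ ℓ} {us} (_ , ℓ≤) vs) ws) G e inj iso =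
    conclude (Build.build A₂.good
      (A₂.isolated-frame (A₁.isolated-frame (iso zero) (λ _ → zero≢)) (λ _ → zero≢))
      A₂.leg leg-z (zero≢ ∘ sym) (zero≢ ∘ sym) (in₁≢in₂ zero zero ∘ sym)
      (Dismantled.outv-frame D₂ leg-z (in₁≢in₂ zero zero)
        (proj₂ (proj₂ outv-z))) ℓ≤k)
    where
    in₁ : Fin (suc (darts us)) → Fin (suc (darts (node (+ ℓ) us ∷ ts)))
    in₁ = in-us us ts
    in₂ : Fin (suc (darts ts)) → Fin (suc (darts (node (+ ℓ) us ∷ ts)))
    in₂ = in-ts us ts
    in₁≢in₂ : ∀ i j → e (in₁ i) ≢ e (in₂ j)
    in₁≢in₂ i j eq with () ← trans (sym (splitAt-↑ˡ (suc (darts us)) i (suc (darts ts))))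
      (trans (cong (splitAt (suc (darts us))) (suc-injective (inj eq))) (splitAt-↑ʳ (suc (darts us)) (suc (darts ts)) j))
    zero≢ : ∀ {i} → e (suc i) ≢ e zero
    zero≢ eq with () ← inj eq
    A₁ : Assembled us s₀ (e ∘ in₁)
    A₁ = assemble vs G (e ∘ in₁) (λ eq → ↑ˡ-injective _ _ _ (suc-injective (inj eq))) (iso ∘ in₁)
    module A₁ = Assembled A₁
    A₂ : Assembled ts A₁.whole (e ∘ in₂)
    A₂ = assemble ws A₁.good (e ∘ in₂) (λ eq → ↑ʳ-injective (suc (darts us)) _ _ (suc-injective (inj eq)))
           (λ j → A₁.isolated-frame (iso (in₂ j)) (λ i → in₁≢in₂ i j))
    module A₂ = Assembled A₂
    D₂ : Dismantled ts A₂.whole (e (in₂ zero)) A₁.whole (enum A₂.dismantles)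
    D₂ = dismantled A₂.good A₂.leg A₂.dismantles
    leg-z : Leg A₂.whole (e (in₁ zero))
    leg-z = A₂.leg-frame A₁.leg (λ j → in₁≢in₂ zero j ∘ sym)
    outv-z : ∃ λ k → + k ≡ total us × Count (σ A₁.whole) (Orbit (φ A₁.whole) (e (in₁ zero))) k
    outv-z = Dismantled.outv-root (dismantled A₁.good A₁.leg A₁.dismantles)
    ℓ≤k : ℓ ≤ proj₁ outv-z
    ℓ≤k = ℤ.drop‿+≤+ (subst (+ ℓ ℤ.≤_) (sym (proj₁ (proj₂ outv-z))) ℓ≤)
    conclude : (∃ λ s → Good s × Leg s (e zero) × Step s (e zero) ℓ (e (in₂ zero)) (e (in₁ zero)) A₂.whole) →
               Assembled (node (+ ℓ) us ∷ ts) s₀ e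
    conclude (s , good , leg , S₀) = record
      { good           = good
      ; dismantles     = step S₀ A₂.dismantles A₁.dismantles
      ; leg            = leg
      ; enum-≗         = λ { zero → refl ; (suc i) → enum-suc i }
      ; leg-frame      = leg-frame
      ; leg-origin     = leg-origin
      ; isolated-frame = λ iso off → Cut.isolated-origin C
          (A₂.isolated-frame (A₁.isolated-frame iso (off ∘ in₁)) (off ∘ in₂))
          (off zero ∘ sym) (off (in₂ zero) ∘ sym) (off (in₁ zero) ∘ sym)
      }
      where
      C : Cut s (e zero) ℓ (e (in₂ zero)) (e (in₁ zero)) A₂.whole
      C = cut good leg S₀
      enum-suc : ∀ i → enum (step S₀ A₂.dismantles A₁.dismantles) (suc i) ≡ e (suc i)
      enum-suc i with splitAt (suc (darts us)) i in eq
      ... | inj₁ j = trans (A₁.enum-≗ j) (cong (e ∘ suc) (splitAt⁻¹-↑ˡ eq))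
      ... | inj₂ j = trans (A₂.enum-≗ j) (cong (e ∘ suc) (splitAt⁻¹-↑ʳ eq))
      outside : ∀ {d} → e zero ≢ d → (∀ i → e (in₁ i) ≢ d) → (∀ i → e (in₂ i) ≢ d) → ∀ i → e i ≢ d
      outside off₀ off₁ off₂ zero = off₀
      outside off₀ off₁ off₂ (suc i) with splitAt (suc (darts us)) i in eq
      ... | inj₁ j = λ ei≡d → off₁ j (trans (cong (e ∘ suc) (splitAt⁻¹-↑ˡ eq)) ei≡d)
      ... | inj₂ j = λ ei≡d → off₂ j (trans (cong (e ∘ suc) (splitAt⁻¹-↑ʳ eq)) ei≡d)
      leg-origin : ∀ {d} → Leg s d → d ≡ e zero ⊎ ∀ i → e i ≢ d
      leg-origin {d} l with e zero ≟ d
      ... | yes eq = inj₁ (sym eq)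
      ... | no ≢d with A₂.leg-origin (Cut.leg-keep C l)
      ...   | inj₁ d≡y = contradiction d≡y (proj₁ (Cut.leg-≢ C l))
      ...   | inj₂ off₂ with A₁.leg-origin (Dismantled.leg-keep D₂ (Cut.leg-keep C l))
      ...     | inj₁ d≡z = contradiction d≡z (proj₂ (Cut.leg-≢ C l))
      ...     | inj₂ off₁ = inj₂ (outside ≢d off₁ off₂)
      leg-frame : ∀ {d} → Leg s₀ d → (∀ i → e i ≢ d) → Leg s d
      leg-frame l off with Cut.leg-origin C (A₂.leg-frame (A₁.leg-frame l (off ∘ in₁)) (off ∘ in₂))
      ... | inj₁ l = l
      ... | inj₂ (inj₁ d≡y) = contradiction (sym d≡y) (off (in₂ zero))
      ... | inj₂ (inj₂ d≡z) = contradiction (sym d≡z) (off (in₁ zero))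

injective⇒surjective : ∀ {a b} {f : Fin a → Fin b} → a ≡ b → Injective _≡_ _≡_ f → ∀ y → ∃ λ x → f x ≡ y
injective⇒surjective {f = f} refl inj y with t , per ← period inj y = f ^[ t ] y , per

toPermutation : ∀ {f : Fin m → Fin m} → Injective _≡_ _≡_ f → Permutation′ m
toPermutation {f = f} inj = permutation f (λ y → proj₁ (onto y)) (λ y → proj₂ (onto y))
  (λ x → inj (proj₂ (onto (f x))))
  where
  onto = injective⇒surjective {f = f} refl inj

-- Adding the root as a dart

lift : (Fin m → Fin m) → Fin (suc m) → Fin (suc m)
lift f zero    = zero
lift f (suc d) = suc (f d)

opaque
  restrict : ∀ {f : Fin (suc m) → Fin (suc m)} → Injective _≡_ _≡_ f → f zero ≡ zero →
             ∃ λ (ρ : Permutation′ m) → lift (ρ ⟨$⟩ʳ_) ≗ f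
  restrict {m = m} {f = f} inj eq = remove zero π , λ
    { zero → sym eq ; (suc d) → lift₀-remove π eq (suc d) }
    where
    π : Permutation′ (suc m)
    π = toPermutation {f = f} inj

lift-injective : ∀ {f : Fin m → Fin m} → Injective _≡_ _≡_ f → Injective _≡_ _≡_ (lift f)
lift-injective inj {zero}  {zero}  _  = refl
lift-injective inj {suc _} {suc _} eq = cong suc (inj (suc-injective eq))

drop : Fin m → Fin (suc m) → Fin m
drop r zero    = r
drop r (suc d) = d

drop-transpose : ∀ (r : Fin m) d → drop r (transpose zero (suc r) d) ≡ drop r d
drop-transpose r d with transposeView zero (suc r) d
... | left      = cong (drop r) (transpose-left zero (suc r))
... | right     = cong (drop r) (transpose-right zero (suc r))
... | other p q = cong (drop r) (transpose-other p q)

insert : (Fin m → Fin m) → Fin m → Fin (suc m) → Fin (suc m)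
insert f r = lift f [ zero ⇄ suc r ]

orbit-lift : ∀ {f : Fin m → Fin m} {r d e} → Orbit f d e → Orbit (insert f r) (suc d) (suc e)
orbit-lift {f = f} = drop-edge (Eq.return (transpose-left zero (suc _))) ∘ ≈-⊆ (⇄-≈ (lift f)) ∘ Eq.gmap suc (cong suc)

orbit-drop : ∀ {f : Fin m → Fin m} {r} d → Orbit f (drop r d) (drop r (insert f r d))
orbit-drop {f = f} {r} zero    = subst (Orbit f r) (sym (drop-transpose r zero)) ε
orbit-drop {f = f} {r} (suc d) = subst (Orbit f d) (sym (drop-transpose r (suc (f d)))) next

root-drop : ∀ {f : Fin m → Fin m} {r} d → Orbit (insert f r) (suc (drop r d)) d
root-drop zero    = ~sym (Eq.return (transpose-left zero (suc _)))
root-drop (suc d) = ε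

insert-classes : ∀ {f : Fin m → Fin m} {r} → Classes (Graph f) k → Classes (Graph (insert f r)) k
insert-classes {f = f} {r} c = record
  { class      = class ∘ drop r
  ; surjective = λ i → suc (representative c i) , λ { refl → class-representative c i }
  ; same-class = mk⇔
      (λ {eq → ~sym (root-drop _) ◅◅ orbit-lift (Equivalence.to same-class eq) ◅◅ root-drop _})
      (Eq.gfold isEquivalence (class ∘ drop r) λ { {d} refl → Equivalence.from same-class (orbit-drop d) })
  }
  where open Classes c

lift-classes : ∀ {f : Fin m → Fin m} → Classes (Graph f) k → Classes (Graph (lift f)) (suc k)
lift-classes {m = m} {k = k} {f = f} c = record
  { class      = class⁺
  ; surjective = λ { zero → zero , λ { refl → refl }
                   ; (suc i) → suc (representative c i) , λ { refl → cong suc (class-representative c i) } }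
  ; same-class = λ {d} {e} → mk⇔ (to d e) (Eq.gfold isEquivalence class⁺ λ
      { {zero} refl → refl ; {suc d} refl → cong suc (Equivalence.from same-class next) })
  }
  where
  open Classes c
  class⁺ : Fin (suc m) → Fin (suc k)
  class⁺ zero    = zero
  class⁺ (suc d) = suc (class d)
  to : ∀ d e → class⁺ d ≡ class⁺ e → Orbit (lift f) d e
  to zero    zero    _  = ε
  to (suc d) (suc e) eq = Eq.gmap suc (cong suc) (Equivalence.to same-class (suc-injective eq))

-- Each orbit of an involution without fixed points consists of a representative and its image.
cyc-involution : ∀ {a : Fin m → Fin m} → (∀ d → a (a d) ≡ d) → (∀ d → a d ≢ d) → cyc a * 2 ≡ m
cyc-involution {m = m} {a = a} inv fixfree = ℕ.≤-antisym
  (injective⇒≤ {f = λ i → pair (remQuot 2 i)} λ {i} {j} eq →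
    trans (sym (combine-remQuot {cyc a} 2 i)) (trans (cong (uncurry combine) (pair-injective _ _ eq)) (combine-remQuot {cyc a} 2 j)))
  (injective⇒≤ {f = λ d → combine (class d) (side d)} λ {d} {e} eq →
    let (c≡ , s≡) = combine-injective (class d) (side d) (class e) (side e) eq in side-injective d e c≡ s≡)
  where
  open Classes (cyc-classes a)
  rep : Fin (cyc a) → Fin m
  rep = representative (cyc-classes a)
  inj : Injective _≡_ _≡_ a
  inj eq = trans (sym (inv _)) (trans (cong a eq) (inv _))
  pair : Fin (cyc a) × Fin 2 → Fin m
  pair (i , zero)  = rep i
  pair (i , suc _) = a (rep i)
  class-pair : ∀ i b → class (pair (i , b)) ≡ i
  class-pair i zero    = class-representative (cyc-classes a) i
  class-pair i (suc _) = trans (sym (Equivalence.from same-class next)) (class-representative (cyc-classes a) i)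
  pair-injective : ∀ x y → pair x ≡ pair y → x ≡ y
  pair-injective (i , b) (j , c) eq
    with refl ← trans (sym (class-pair i b)) (trans (cong class eq) (class-pair j c)) = cong (i ,_) (sides b c eq)
    where
    sides : ∀ b c → pair (i , b) ≡ pair (i , c) → b ≡ c
    sides zero       zero       _  = refl
    sides zero       (suc zero) eq = contradiction (sym eq) (fixfree _)
    sides (suc zero) zero       eq = contradiction eq (fixfree _)
    sides (suc zero) (suc zero) _  = refl
  side : Fin m → Fin 2
  side d with rep (class d) ≟ d
  ... | yes _ = zero
  ... | no _  = suc zero
  orbit-of : ∀ d → d ≡ rep (class d) ⊎ d ≡ a (rep (class d))
  orbit-of d = orbit-closed {C = λ e → e ≡ rep (class d) ⊎ e ≡ a (rep (class d))} inj
    (λ { (inj₁ refl) → inj₂ refl ; (inj₂ refl) → inj₁ (inv _) }) (inj₁ refl)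
    (Equivalence.to same-class (class-representative (cyc-classes a) (class d)))
  side-injective : ∀ d e → class d ≡ class e → side d ≡ side e → d ≡ e
  side-injective d e c≡ s≡ with rep (class d) ≟ d | rep (class e) ≟ e
  ... | yes p | yes q = trans (sym p) (trans (cong rep c≡) q)
  ... | no p  | no q with orbit-of d | orbit-of e
  ...   | inj₁ p′ | _       = contradiction (sym p′) p
  ...   | inj₂ _  | inj₁ q′ = contradiction (sym q′) q
  ...   | inj₂ p′ | inj₂ q′ = trans p′ (trans (cong (a ∘ rep) c≡) (sym q′))

extend : (Fin m → Fin m) → (Fin m → Fin m) → Fin m → State (suc m)
extend σ₀ α₀ r = σ⇄ zero (suc r) (state (lift σ₀) (lift α₀))

module _ {σ₀ α₀ : Fin m → Fin m} {r : Fin m} where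
  private
    s : State (suc m)
    s = extend σ₀ α₀ r

  φ-extend : φ s ≗ insert (σ₀ ∘ α₀) r
  φ-extend zero    = refl
  φ-extend (suc d) = refl

  α-drop : ∀ d → EqClosure (Graph σ₀ ∪ Graph α₀) (drop r d) (drop r (lift α₀ d))
  α-drop zero    = ε
  α-drop (suc d) = Eq.return (inj₂ refl)

  connected-drop : ∀ {d e} → Connected s d e → EqClosure (Graph σ₀ ∪ Graph α₀) (drop r d) (drop r e)
  connected-drop = Eq.gfold (Eq.isEquivalence _) (drop r) λ
    { {d} (inj₁ refl) → ∪ˡ (orbit-drop d) ; {d} (inj₂ refl) → α-drop d }

  connected-lift : ∀ {d e} → EqClosure (Graph σ₀ ∪ Graph α₀) d e → Connected s (suc d) (suc e)
  connected-lift = Eq.gfold (Eq.isEquivalence _) suc λ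
    { (inj₁ refl) → orbit-σ s (orbit-lift next) ; (inj₂ refl) → orbit-α s next }

  comp-extend : (∀ d e → EqClosure (Graph σ₀ ∪ Graph α₀) d e) → comp s ≡ 1
  comp-extend con = Classes-unique (comp-classes s) (record
    { class      = λ _ → zero
    ; surjective = λ { zero → zero , λ _ → refl }
    ; same-class = λ {d} {e} → mk⇔
        (λ _ → ~sym (orbit-σ s (root-drop d)) ◅◅ connected-lift (con (drop r d) (drop r e)) ◅◅ orbit-σ s (root-drop e))
        (λ _ → refl)
    })

  χ-extend : χ s ≡ cyc σ₀ + cyc (σ₀ ∘ α₀) + suc (cyc α₀)
  χ-extend = cong₂ _+_ (cong₂ _+_
    (Classes-unique (cyc-classes (σ s)) (insert-classes (cyc-classes σ₀)))
    (trans (cyc-cong φ-extend) (Classes-unique (cyc-classes (insert (σ₀ ∘ α₀) r)) (insert-classes (cyc-classes (σ₀ ∘ α₀))))))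
    (Classes-unique (cyc-classes (α s)) (lift-classes (cyc-classes α₀)))

empty : State m
empty = state id id

good-empty : Good (empty {m})
good-empty {m} = record
  { planar     = record { σ-injective = id ; α-involutive = λ _ → refl ; euler =
      trans (cong₂ _+_ (cong₂ _+_ (cyc-id λ _ → refl) (cyc-id λ _ → refl)) (cyc-id λ _ → refl))
        (trans (arith m) (cong (λ c → m + 2 * c) (Classes-unique comp′ (comp-classes empty)))) }
  ; leg-exists = λ d → d , refl , ε
  ; leg-unique = λ _ _ r → sym (isolated-connected {s = empty} id id (refl , refl) r)
  }
  where
  comp′ : Classes (Linked (empty {m})) m
  comp′ = Classes-resp (λ ()) (λ { (inj₁ refl) → ε ; (inj₂ refl) → ε }) discrete
  arith : ∀ m → m + m + m ≡ m + 2 * m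
  arith = solve-∀

lookup-injective : ∀ {xs : List A} → Unique xs → ∀ i j → lookup xs i ≡ lookup xs j → i ≡ j
lookup-injective (x∉ ∷ u) zero    zero    _  = refl
lookup-injective (x∉ ∷ u) zero    (suc j) eq = contradiction eq (All.lookup x∉ (∈-lookup j))
lookup-injective (x∉ ∷ u) (suc i) zero    eq = contradiction (sym eq) (All.lookup x∉ (∈-lookup i))
lookup-injective (x∉ ∷ u) (suc i) (suc j) eq = cong suc (lookup-injective u i j eq)

ext : RootedPlanarMap n → State (suc (2 * n))
ext singleVertex  = empty
ext (fromDarts M) = extend (σ₀ ⟨$⟩ʳ_) α₀ root
  where open CombinatorialMap M renaming (σ to σ₀; α to α₀)

record Rooted {n} (M : RootedPlanarMap n) : Set where
  field
    good     : Good (ext M)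
    leg      : Leg (ext M) zero
    only-leg : ∀ {l} → Leg (ext M) l → l ≡ zero
    edges    : cyc (α (ext M)) ≡ suc n
    outer    : Count (σ (ext M)) (Orbit (φ (ext M)) zero) (outv M)

opaque
  rooted : (M : RootedPlanarMap n) → Rooted M
  rooted singleVertex = record
    { good = good-empty ; leg = refl ; only-leg = λ { {zero} _ → refl } ; edges = cyc-id λ _ → refl
    ; outer = outer-isolated (planar good-empty) (refl , refl) }
  rooted {n = n} (fromDarts M) = record
    { good     = record
      { planar     = record
        { σ-injective  = ⇄-injective {f = lift f} (lift-injective f-inj)
        ; α-involutive = λ { zero → refl ; (suc d) → cong suc (M.α-involutive d) }
        ; euler        = trans χ-extend (trans (cong₂ _+_ (cong₂ _+_ V≡ F≡) (cong suc α≡))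
            (trans (cong (_+ suc n) M.euler) (trans (arith n) (cong (λ c → suc (2 * n) + 2 * c) (sym (comp-extend connected))))))
        }
      ; leg-exists = λ d → zero , refl , to-root d
      ; leg-unique = λ u v _ → trans (only-leg u) (sym (only-leg v))
      }
    ; leg      = refl
    ; only-leg = only-leg
    ; edges    = trans (Classes-unique (cyc-classes (lift α₀)) (lift-classes (cyc-classes α₀))) (cong suc α≡)
    ; outer    = record
      { point        = λ i → suc (witness i)
      ; point-in     = λ i → Eq.return (transpose-left zero (suc root)) ◅◅
          Orbit-resp (sym ∘ φ-extend {σ₀ = f} {α₀}) (orbit-lift (Equivalence.to F.same-class (sym (proj₂ (proj₂ (on-face i))))))
      ; point-unique = λ i j r → lookup-injective (filter⁺ onOuterFace? (allFin⁺ #vertices)) i j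
          (trans (sym (proj₁ (proj₂ (on-face i))))
            (trans (Equivalence.from V⁺.same-class r) (proj₁ (proj₂ (on-face j)))))
      ; cover        = λ d r →
          let v∈ = ∈-filter⁺ onOuterFace? (∈-allFin (vertexOf (drop root d)))
                     (drop root d , refl , sym (Equivalence.from F⁺.same-class (Orbit-resp φ-extend r)))
          in index v∈ , Equivalence.to V⁺.same-class (trans (lookup-index v∈) (sym (proj₁ (proj₂ (on-face (index v∈))))))
      }
    }
    where
    module M = CombinatorialMap M
    open CombinatorialMap M using (root; connected; #vertices; vertexOf; faceOf; OnOuterFace; onOuterFace?; vertices; faces)
      renaming (σ to σ₀; α to α₀)
    s : State (suc (2 * n))
    s = ext (fromDarts M)
    f : Fin (2 * n) → Fin (2 * n)
    f = σ₀ ⟨$⟩ʳ_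
    f-inj : Injective _≡_ _≡_ f
    f-inj eq = trans (sym (inverseˡ σ₀)) (trans (cong (σ₀ ⟨$⟩ˡ_) eq) (inverseˡ σ₀))
    V≡ : cyc f ≡ #vertices
    V≡ = Classes-unique (cyc-classes f) vertices
    F≡ : cyc (f ∘ α₀) ≡ M.#faces
    F≡ = Classes-unique (cyc-classes (f ∘ α₀)) faces
    α≡ : cyc α₀ ≡ n
    α≡ = ℕ.*-cancelʳ-≡ (cyc α₀) n 2 (trans (cyc-involution M.α-involutive M.α-fixfree) (ℕ.*-comm 2 n))
    arith : ∀ n → n + 2 + suc n ≡ suc (2 * n) + 2 * 1
    arith = solve-∀
    only-leg : ∀ {l} → Leg s l → l ≡ zero
    only-leg {zero}  _  = refl
    only-leg {suc d} eq = contradiction (suc-injective eq) (M.α-fixfree d)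
    to-root : ∀ d → Connected s d zero
    to-root d = ~sym (orbit-σ s (root-drop d)) ◅◅ connected-lift (connected (drop root d) root) ◅◅ orbit-σ s (root-drop zero)
    module F = Classes faces
    module V⁺ = Classes (insert-classes {r = root} vertices)
    module F⁺ = Classes (insert-classes {r = root} faces)
    outer-vertices : List (Fin #vertices)
    outer-vertices = filter onOuterFace? (allFin #vertices)
    on-face : ∀ i → OnOuterFace (lookup outer-vertices i)
    on-face i = proj₂ (∈-filter⁻ onOuterFace? {xs = allFin #vertices} (∈-lookup i))
    witness : Fin (outv (fromDarts M)) → Fin (2 * n)
    witness i = proj₁ (on-face i)

opaque
  fromState : ∀ n {s : State (suc (2 * n))} → Good s → Leg s zero → (∀ {l} → Leg s l → l ≡ zero) →
              ∃ λ (M : RootedPlanarMap n) → ext M ≗ₛ s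
  fromState zero    G leg only = singleVertex , (λ { zero → one _ }) , (λ { zero → one _ })
    where
    one : ∀ (d : Fin 1) → zero ≡ d
    one zero = refl
  fromState (suc n) {s} G leg only = go (σ s zero) refl
    where
    P : Planar s
    P = planar G
    go : ∀ d → σ s zero ≡ d → ∃ λ (M : RootedPlanarMap (suc n)) → ext M ≗ₛ s
    go zero σz with l , leg-l , r ← leg-exists G (suc zero) with refl ← only leg-l
      with () ← isolated-connected (σ-injective P) (α-injective P) (σz , leg) (~sym r)
    go (suc r) σz = fromDarts (record
          { σ            = f₀
      ; α            = a₀ ⟨$⟩ʳ_
      ; α-involutive = involutive
      ; α-fixfree    = fixfree
      ; connected    = connected
      ; root         = r
      ; #vertices    = V
      ; #faces       = F
      ; vertices     = cyc-classes _
      ; faces        = cyc-classes _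
      ; euler        = ℕ.+-cancelʳ-≡ (suc (suc n)) _ _ (trans (cong (λ a → V + F + suc a) (sym α≡))
          (trans (sym χ-extend) (trans (euler (Planar-resp (≗ₛ-sym E≗s) P))
            (trans (cong (λ c → suc (2 * suc n) + 2 * c) (comp-extend connected)) (sym (arith (suc n)))))))
      }) , E≗s
      where
      restrict-σ : ∃ λ (ρ : Permutation′ (2 * suc n)) → lift (ρ ⟨$⟩ʳ_) ≗ σ s [ zero ⇄ suc r ]
      restrict-σ = restrict (⇄-injective {f = σ s} {a = zero} {b = suc r} (σ-injective P)) (⇄-right {f = σ s} σz)
      restrict-α : ∃ λ (ρ : Permutation′ (2 * suc n)) → lift (ρ ⟨$⟩ʳ_) ≗ α s
      restrict-α = restrict (α-injective P) leg
      f₀ a₀ : Permutation′ (2 * suc n)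
      f₀ = proj₁ restrict-σ
      a₀ = proj₁ restrict-α
      f≗ : lift (f₀ ⟨$⟩ʳ_) ≗ σ s [ zero ⇄ suc r ]
      f≗ = proj₂ restrict-σ
      a≗ : lift (a₀ ⟨$⟩ʳ_) ≗ α s
      a≗ = proj₂ restrict-α
      V F : ℕ
      V = cyc (f₀ ⟨$⟩ʳ_)
      F = cyc (λ d → f₀ ⟨$⟩ʳ (a₀ ⟨$⟩ʳ d))
      E : State (suc (2 * suc n))
      E = extend (f₀ ⟨$⟩ʳ_) (a₀ ⟨$⟩ʳ_) r
      E≗s : E ≗ₛ s
      E≗s = (λ d → trans (cong (transpose zero (suc r)) (f≗ d)) (transpose-involutive zero (suc r) (σ s d))) , a≗
      involutive : ∀ d → a₀ ⟨$⟩ʳ (a₀ ⟨$⟩ʳ d) ≡ d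
      involutive d = suc-injective (trans (a≗ (suc (a₀ ⟨$⟩ʳ d))) (trans (cong (α s) (a≗ (suc d))) (α-involutive P (suc d))))
      fixfree : ∀ d → a₀ ⟨$⟩ʳ d ≢ d
      fixfree d eq with () ← only (trans (sym (a≗ (suc d))) (cong suc eq))
      connected : ∀ d e → EqClosure (Graph (f₀ ⟨$⟩ʳ_) ∪ Graph (a₀ ⟨$⟩ʳ_)) d e
      connected d e with l , u , x ← leg-exists G (suc d) | l′ , v , y ← leg-exists G (suc e)
        with refl ← only u | refl ← only v =
        connected-drop (Eq.map (Linked-resp (≗ₛ-sym E≗s)) (x ◅◅ ~sym y))
      α≡ : cyc (a₀ ⟨$⟩ʳ_) ≡ suc n
      α≡ = ℕ.*-cancelʳ-≡ (cyc (a₀ ⟨$⟩ʳ_)) (suc n) 2 (trans (cyc-involution involutive fixfree) (ℕ.*-comm 2 (suc n)))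
      arith : ∀ n → n + 2 + suc n ≡ suc (2 * n) + 2 * 1
      arith = solve-∀

≅⇒Iso : ∀ {M N : RootedPlanarMap n} → M ≅ N → ∃ λ π → Iso π (ext M) (ext N) × π zero ≡ zero
≅⇒Iso singleVertex = id , record { injective = id ; π-σ = λ _ → refl ; π-α = λ _ → refl } , refl
≅⇒Iso (fromDarts {M = M} {N} i) = lift (I.π ⟨$⟩ʳ_) ,
  Iso-σ⇄ {s = state (lift (M.σ ⟨$⟩ʳ_)) (lift M.α)} {t = state (lift (N.σ ⟨$⟩ʳ_)) (lift N.α)} {a = zero}
    refl (cong suc I.π-root) (record
      { injective = lift-injective (λ eq → trans (sym (inverseˡ I.π)) (trans (cong (I.π ⟨$⟩ˡ_) eq) (inverseˡ I.π)))
      ; π-σ       = λ { zero → refl ; (suc d) → cong suc (I.π-σ d) }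
      ; π-α       = λ { zero → refl ; (suc d) → cong suc (I.π-α d) }
      }) , refl
  where
  module I = Isomorphism i
  module M = CombinatorialMap M
  module N = CombinatorialMap N

Iso⇒≅ : ∀ (M N : RootedPlanarMap n) {π} → Iso π (ext M) (ext N) → π zero ≡ zero → M ≅ N
Iso⇒≅ singleVertex  singleVertex  I πz = singleVertex
Iso⇒≅ singleVertex  (fromDarts N) I πz with () ← CombinatorialMap.root N
Iso⇒≅ (fromDarts M) singleVertex  I πz with () ← CombinatorialMap.root M
Iso⇒≅ {n = n} (fromDarts M) (fromDarts N) {π} I πz with ρ , ρ≗ ← restrict (injective I) πz = fromDarts record
  { π      = ρ
  ; π-σ    = λ d → suc-injective (trans (ρ≗ (suc (M.σ ⟨$⟩ʳ d))) (trans (π-σ I₀ (suc d))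
               (cong (lift (N.σ ⟨$⟩ʳ_)) (sym (ρ≗ (suc d))))))
  ; π-α    = λ d → suc-injective (trans (ρ≗ (suc (M.α d))) (trans (π-α I (suc d)) (cong (lift N.α) (sym (ρ≗ (suc d))))))
  ; π-root = suc-injective (trans (ρ≗ (suc M.root)) πroot)
  }
  where
  module M = CombinatorialMap M
  module N = CombinatorialMap N
  πroot : π (suc M.root) ≡ suc N.root
  πroot = trans (cong π (sym (transpose-left zero (suc M.root)))) (trans (π-σ I zero)
    (trans (cong (σ (ext (fromDarts N))) πz) (transpose-left zero (suc N.root))))
  I₀ : Iso π (state (lift (M.σ ⟨$⟩ʳ_)) (lift M.α)) (state (lift (N.σ ⟨$⟩ʳ_)) (lift N.α))
  I₀ = Iso-resp
    ((λ d → transpose-involutive zero (suc M.root) (lift (M.σ ⟨$⟩ʳ_) d)) , λ _ → refl)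
    ((λ d → transpose-involutive zero (suc N.root) (lift (N.σ ⟨$⟩ʳ_) d)) , λ _ → refl)
    (Iso-σ⇄ πz πroot I)

-- The bijection

module _ {ts : List LabelledTree} (c : All (AllNodes NonRootCondition) ts) where
  leaf-condition : ∀ {ℓ us} → NonRootCondition (node ℓ us) → LeafCondition (node ℓ us)
  leaf-condition {+ zero}          _ _ = inj₁ refl
  leaf-condition {+ suc zero}      _ _ = inj₂ refl
  leaf-condition {+ suc (suc _)}   (_ , +≤+ (s≤s ())) refl
  leaf-condition {ℤ.-[1+ _ ]} (() , _)

  leaf-conditions : ∀ {us} → All (AllNodes NonRootCondition) us → All (AllNodes LeafCondition) us
  leaf-conditions []              = []
  leaf-conditions (node p vs ∷ us) = node (leaf-condition p) (leaf-conditions vs) ∷ leaf-conditions us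

  isVTree : IsVTree (node (total ts) ts)
  isVTree = record
    { leaves  = node (λ { refl → inj₂ refl }) (leaf-conditions c)
    ; nonRoot = c
    ; root    = refl
    }

module _ {n : ℕ} (M : RootedPlanarMap n) where
  private
    module R = Rooted (rooted M)

  forest : List LabelledTree
  forest = proj₁ (dismantle R.good R.leg)

  end : State (suc (2 * n))
  end = proj₁ (proj₂ (dismantle R.good R.leg))

  dismantling : Dismantles forest (ext M) zero end
  dismantling = proj₂ (proj₂ (dismantle R.good R.leg))

  module D = Dismantled (dismantled R.good R.leg dismantling)

  leg-listed : ∀ {l} → Leg end l → ∃ λ i → l ≡ enum dismantling i
  leg-listed leg with D.leg-origin leg
  ... | inj₁ leg = zero , R.only-leg leg
  ... | inj₂ e   = e

  enum-onto : ∀ d → ∃ λ i → enum dismantling i ≡ d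
  enum-onto d with l , leg-l , r ← leg-exists D.good-end d with i , refl ← leg-listed leg-l =
    i , sym (isolated-connected (σ-injective P) (α-injective P) (D.enum-isolated i) (~sym r))
    where P = planar D.good-end

  end-isolated : ∀ d → Isolated end d
  end-isolated d with i , refl ← enum-onto d = D.enum-isolated i

  forest-edges : #edges′ forest ≡ n
  forest-edges = ℕ.+-cancelˡ-≡ (suc n) _ _ (begin
    suc n + #edges′ forest           ≡⟨ cong (_+ #edges′ forest) R.edges ⟨
    cyc (α (ext M)) + #edges′ forest ≡⟨ D.edges ⟨
    cyc (α end)                      ≡⟨ cyc-id (proj₂ ∘ end-isolated) ⟩
    suc (2 * n)                      ≡⟨ cong (λ k → suc (n + k)) (ℕ.+-identityʳ n) ⟩
    suc n + n                        ∎)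
    where open ≡-Reasoning

  darts-forest : darts forest ≡ 2 * n
  darts-forest = trans (darts-edges forest) (cong (2 *_) forest-edges)

  vtree : VTree n
  vtree = record { tree = node (total forest) forest ; isVTree = isVTree D.conditions ; size = forest-edges }

  vtree-label : rootLabel vtree ≡ + outv M
  vtree-label with k , eq , c ← D.outv-root = trans (sym eq) (cong +_ (Count-unique c R.outer))

same-enum : ∀ {m} {ts ts₁ : List LabelledTree} {s s₀ t t₀ : State m} {p p₁ : Fin m}
            (u : Dismantles ts s p s₀) (v : Dismantles ts₁ t p₁ t₀) → ts ≡ ts₁ →
            Good s → Good t → Leg s p → Leg t p₁ → (∀ d → Isolated s₀ d) → (∀ d → Isolated t₀ d) →
            suc (darts ts) ≡ m → (∀ d → ∃ λ i → enum u i ≡ d) → (∀ d → ∃ λ i → enum v i ≡ d) →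
            ∃ λ π → Iso π s t × π p ≡ p₁
same-enum {m} {ts} {s₀ = s₀} {t₀ = t₀} u v refl Gs Gt l l₁ is it size onto-u onto-v =
  π , dismantles-backward Gs Gt l l₁ u v I π-enum , π-enum zero
  where
  module _ {e : Fin (suc (darts ts)) → Fin m} (onto : ∀ d → ∃ λ i → e i ≡ d) where
    section-injective : Injective _≡_ _≡_ (proj₁ ∘ onto)
    section-injective {d} {d′} eq = trans (sym (proj₂ (onto d))) (trans (cong e eq) (proj₂ (onto d′)))
    section-left : ∀ i → proj₁ (onto (e i)) ≡ i
    section-left i with d , refl ← injective⇒surjective (sym size) section-injective i =
      cong (proj₁ ∘ onto) (proj₂ (onto d))
  π : Fin m → Fin m
  π d = enum v (proj₁ (onto-u d))
  π-enum : ∀ i → π (enum u i) ≡ enum v i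
  π-enum i = cong (enum v) (section-left onto-u i)
  I : Iso π s₀ t₀
  I = record
    { injective = λ eq → section-injective onto-u
        (trans (sym (section-left onto-v _)) (trans (cong (proj₁ ∘ onto-v) eq) (section-left onto-v _)))
    ; π-σ       = λ d → trans (cong π (proj₁ (is d))) (sym (proj₁ (it (π d))))
    ; π-α       = λ d → trans (cong π (proj₂ (is d))) (sym (proj₂ (it (π d))))
    }

module _ {M N : RootedPlanarMap n} where
  private
    module R = Rooted (rooted M)
    module S = Rooted (rooted N)

  forest-cong : M ≅ N → forest M ≡ forest N
  forest-cong M≅N with π , I , πz ← ≅⇒Iso M≅N =
    proj₁ (dismantles-forward R.good S.good R.leg S.leg I πz (dismantling M) (dismantling N))

  forest-injective : forest M ≡ forest N → M ≅ N
  forest-injective eq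
    with π , I , πz ← same-enum (dismantling M) (dismantling N) eq R.good S.good R.leg S.leg
      (end-isolated M) (end-isolated N) (cong suc (darts-forest M)) (enum-onto M) (enum-onto N) = Iso⇒≅ M N I πz

forest-surjective : ∀ ts → All (AllNodes NonRootCondition) ts → ∃ λ (M : RootedPlanarMap (#edges′ ts)) → forest M ≡ ts
forest-surjective ts c = M , proj₁ (dismantles-forward R.good A.good R.leg A.leg identity refl (dismantling M) A.dismantles)
  where
  size : suc (darts ts) ≡ suc (2 * #edges′ ts)
  size = cong suc (darts-edges ts)
  e : Fin (suc (darts ts)) → Fin (suc (2 * #edges′ ts))
  e = cast size
  e-injective : Injective _≡_ _≡_ e
  e-injective {i} {j} eq = toℕ-injective (trans (sym (toℕ-cast size i)) (trans (cong toℕ eq) (toℕ-cast size j)))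
  assembled : Assembled ts empty e
  assembled = assemble c good-empty e e-injective (λ _ → refl , refl)
  module A = Assembled assembled
  only : ∀ {l} → Leg A.whole l → l ≡ zero
  only {l} leg with A.leg-origin leg
  ... | inj₁ eq  = eq
  ... | inj₂ off = contradiction (cast-involutive size (sym size) l) (off (cast (sym size) l))
  built : ∃ λ (M : RootedPlanarMap (#edges′ ts)) → ext M ≗ₛ A.whole
  built = fromState (#edges′ ts) A.good A.leg only
  M = proj₁ built
  module R = Rooted (rooted M)
  identity : Iso id (ext M) A.whole
  identity = record { injective = id ; π-σ = proj₁ (proj₂ built) ; π-α = proj₂ (proj₂ built) }

theorem4 : (n : ℕ) → Σ[ ρ ∈ Bijection (𝓜 n) (𝓥 n) ] ((M : RootedPlanarMap n) → rootLabel (Bijection.to ρ M) ≡ + outv M)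
theorem4 n = record
  { to        = vtree
  ; cong      = cong root-node ∘ forest-cong
  ; bijective = (λ {M} {N} eq → forest-injective (cong children eq)) , surjective
  } , vtree-label
  where
  root-node : List LabelledTree → LabelledTree
  root-node ts = node (total ts) ts
  surjective : ∀ (T : VTree n) → ∃ λ M → ∀ {N} → N ≅ M → root-node (forest N) ≡ VTree.tree T
  surjective record { tree = node ℓ ts ; isVTree = v ; size = refl }
    with M , eq ← forest-surjective ts (IsVTree.nonRoot v) =
    M , λ N≅M → trans (cong root-node (trans (forest-cong N≅M) eq)) (cong (λ ℓ → node ℓ ts) (sym (IsVTree.root v)))
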